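{- Let $p$ be a prime with $p\equiv5\pmod 6$, and let $\alpha\ge0$, $n\ge0$ be integers. Then for every $i\in\{1,2,\dots,p-1\}$, $$\overline{S_9}\big(6p^{2\alpha+2}n+(6i+3p)p^{2\alpha+1}\big)\equiv0\pmod 3.$$
   Context: For $|q|<1$ and a positive integer $k$, write $f_k=\prod_{j\ge1}(1-q^{kj})$. The function $\overline{S_9}(n)$ (number of $9$-Schur overpartitions of $n$) is defined by $\sum_{n\ge0}\overline{S_9}(n)q^n=\prod_{n\ge1}\frac{(1+q^{2n-1})(1-q^{9(2n-1)})}{(1+q^{9(2n-1)})(1-q^{2n-1})}=\frac{f_2^3f_9^2f_{36}}{f_1^2f_4f_{18}^3}$. -}

module Defs where

open import Data.Nat as ℕ using (ℕ; zero; suc; _∸_)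
open import Data.Integer as ℤ using (ℤ; +_; -_)
open import Data.Nat.DivMod using (_%_)
open import Data.Bool using (Bool; true; false; if_then_else_)
open import Data.Nat using (_≡ᵇ_)

Series : Set
Series = ℕ → ℤ

convSum : Series → Series → ℕ → ℕ → ℤ
convSum f g n zero    = f 0 ℤ.* g n
convSum f g n (suc k) = f (suc k) ℤ.* g (n ∸ suc k) ℤ.+ convSum f g n k

_·_ : Series → Series → Series
(f · g) n = convSum f g n n

one : Series
one zero    = + 1
one (suc _) = + 0

divides? : ℕ → ℕ → Bool
divides? zero    n = n ≡ᵇ 0
divides? (suc k) n = (n % suc k) ≡ᵇ 0

-- 1 + q^m  and  1 - q^m  (m ≥ 1)
onePlus : ℕ → Series
onePlus m n = if n ≡ᵇ 0 then + 1 else (if n ≡ᵇ m then + 1 else + 0)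

oneMinus : ℕ → Series
oneMinus m n = if n ≡ᵇ 0 then + 1 else (if n ≡ᵇ m then - (+ 1) else + 0)

-- 1/(1 - q^m) = Σ_j q^{mj}   (m ≥ 1)
invOneMinus : ℕ → Series
invOneMinus m n = if divides? m n then + 1 else + 0

-- 1/(1 + q^m) = Σ_j (-1)^j q^{mj}   (m ≥ 1)
sign : ℕ → ℤ
sign zero = + 1
sign (suc j) = - sign j

invOnePlus : ℕ → Series
invOnePlus zero    n = + 0   -- unused (m ≥ 1 always)
invOnePlus (suc k) n = if divides? (suc k) n then sign (n ℕ./ suc k) else + 0

factor : ℕ → Series
factor m = onePlus m · (oneMinus (9 ℕ.* m) · (invOnePlus (9 ℕ.* m) · invOneMinus m))

partialProd : ℕ → Series
partialProd zero    = one
partialProd (suc k) = factor (2 ℕ.* k ℕ.+ 1) · partialProd k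

-- Number of 9-Schur overpartitions of n: the coefficient of q^n in
--   ∏_{k≥1} (1+q^{2k-1})(1-q^{9(2k-1)}) / ((1+q^{9(2k-1)})(1-q^{2k-1})).
-- Factors with 2k-1 > n equal 1 + O(q^{n+1}), so truncating at K = n
-- factors gives the exact coefficient of q^n.
S9bar : ℕ → ℤ
S9bar n = partialProd n n

{-# OPTIONS --safe #-}
-- Everything is modulo 3. Write φ(q) = Σ q^{j²}, A = φ(q)⁴, B = φ(-q)⁴, and let P be the product of the
-- (1 + q^{2k-1})/(1 - q^{2k-1}), so that the generating function is S = P(q)/P(q⁹) = P⁻⁸. Jacobi's triple
-- product at z = 1 gives P² = φ(q)/φ(-q), hence S A = B, and also φ(q) φ(-q) = φ(-q²)², hence
-- A B = B(q²)². The derivation θ = q d/dq satisfies θA = A - A³ and θB = B - B³, because squares are 0 or 1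
-- modulo 3; applying it to A B = B(q²)² gives (A + B)² = 1, that is, B = -1 - A.
-- Now let U keep the coefficients of index 3n. Then U(A) = A by A = φ(q) φ(q³), and X = A B satisfies
-- X(q) = (1 + A - X)(q²), which forces U(X) = X. Applying U to S A³ = A X = A + X - A(q³) yields
-- U(S) A = A B, so U(S) = B = -1 - A, and the coefficient of q^{3M} in S is, up to sign, the number of
-- representations of M by x² + 3y². Here M is divisible by p to an odd power, and p ≡ 2 (mod 3) is inert
-- for x² + 3y², so there is none.
module Submission where

open import Defs
open import Data.Nat as ℕ using (ℕ; zero; suc; _∸_; _≤_; _<_; z≤n; s≤s; _%_; _≡ᵇ_)
import Data.Nat.Properties as ℕₚ
import Data.Nat.DivMod as DivMod
import Data.Nat.Divisibility as ℕ∣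
open import Data.Nat.Combinatorics using (_C_; nCk+nC[k+1]≡[n+1]C[k+1]; k>n⇒nCk≡0; nCn≡1)
open import Data.Nat.Primality using (Prime; prime?; euclidsLemma; prime⇒nonZero)
open import Data.Nat.Tactic.RingSolver using (solve-∀)
open import Data.Integer as ℤ using (ℤ; +_; -[1+_])
import Data.Integer.Properties as ℤₚ
import Data.Integer.Divisibility.Signed as ℤ∣
open ℤ∣ using (divides)
import Data.Integer.Tactic.RingSolver as ℤSolver
open import Data.Bool using (true; false; if_then_else_)
open import Data.Empty using (⊥; ⊥-elim)
open import Data.Maybe using (Maybe; just; nothing)
open import Data.Product using (∃; _×_; _,_; proj₁; proj₂)
open import Data.Sum using ([_,_]; inj₁; inj₂; reduce)
open import Data.Unit using (tt)
open import Relation.Nullary using (Dec; yes; no; does; ¬_; contradiction)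
open import Relation.Nullary.Decidable using (toWitness)
open import Relation.Binary.PropositionalEquality as ≡ using (_≡_; _≢_; cong; cong₂)
import Relation.Binary.Reasoning.Setoid
open import Algebra.Bundles using (CommutativeRing; RawRing)
import Algebra.Properties.CommutativeSemiring.Exp
import Algebra.Properties.Ring
import Algebra.Solver.Ring
open import Algebra.Solver.Ring.AlmostCommutativeRing using (fromCommutativeRing; _-Raw-AlmostCommutative⟶_)

-- Limits are replaced by nilpotency. Series are taken modulo 3 and modulo q^K, where q^K = 0, and a
-- product of n factors stands for the infinite one as soon as 2 n exceeds K. The product identities
-- use only this and 1 + 1 + 1 = 0, so they are proved in any commutative ring of characteristic 3.
-- Quotients appear as cross-multiplied relations; units are cancelled through nilpotency or through
-- a constant term 1.
--
-- U is additive but not multiplicative, and it only lets factors in q³ pass. Hence the detour over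
-- A³, which is A(q³) in characteristic 3, while S A = B by itself gives no hold on U(S). For the
-- same reason B(q²)² is rewritten as an expression that is linear in A and X.
--
-- Inertness of p is proved without quadratic residues. As p ≡ 2 (mod 3), cubing is a bijection
-- modulo p. Since (x + y)³ + (2 y)³ = (x + 3 y)(x² + 3 y²), a zero of x² + 3 y² modulo p makes the
-- cubes of x + y and -2 y agree, hence x = -3 y.

-- Commutative rings of characteristic 3, with a solver over F₃

data F₃ : Set where
  0₃ 1₃ 2₃ : F₃

infixl 6 _+₃_
infixl 7 _*₃_

_+₃_ _*₃_ : F₃ → F₃ → F₃
0₃ +₃ b  = b
1₃ +₃ 0₃ = 1₃
1₃ +₃ 1₃ = 2₃
1₃ +₃ 2₃ = 0₃
2₃ +₃ 0₃ = 2₃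
2₃ +₃ 1₃ = 0₃
2₃ +₃ 2₃ = 1₃

-₃_ : F₃ → F₃
-₃ 0₃ = 0₃
-₃ 1₃ = 2₃
-₃ 2₃ = 1₃

0₃ *₃ b = 0₃
1₃ *₃ b = b
2₃ *₃ b = -₃ b

F₃-rawRing : RawRing _ _
F₃-rawRing = record
  { Carrier = F₃ ; _≈_ = _≡_ ; _+_ = _+₃_ ; _*_ = _*₃_ ; -_ = -₃_ ; 0# = 0₃ ; 1# = 1₃ }

infix 4 _≟₃_

_≟₃_ : (a b : F₃) → Maybe (a ≡ b)
0₃ ≟₃ 0₃ = just ≡.refl
1₃ ≟₃ 1₃ = just ≡.refl
2₃ ≟₃ 2₃ = just ≡.refl
_  ≟₃ _  = nothing

module Char3 {c ℓ} (R : CommutativeRing c ℓ)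
  (char3 : CommutativeRing._≈_ R
             (CommutativeRing._+_ R (CommutativeRing._+_ R (CommutativeRing.1# R) (CommutativeRing.1# R)) (CommutativeRing.1# R))
             (CommutativeRing.0# R)) where

  open CommutativeRing R
  open Algebra.Properties.Ring ring using (-‿involutive; -‿distribˡ-*; -0#≈0#)
  open Algebra.Properties.CommutativeSemiring.Exp commutativeSemiring public
    using (_^_; ^-homo-*; ^-congˡ; ^-assocʳ; ^-distrib-*)
  open Relation.Binary.Reasoning.Setoid setoid

  private
    embed : F₃ → Carrier
    embed 0₃ = 0#
    embed 1₃ = 1#
    embed 2₃ = - 1#

    1+1≈-1 : 1# + 1# ≈ - 1#
    1+1≈-1 = begin
      1# + 1#                ≈⟨ +-identityʳ _ ⟨
      1# + 1# + 0#           ≈⟨ +-congˡ (-‿inverseʳ 1#) ⟨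
      1# + 1# + (1# - 1#)    ≈⟨ +-assoc _ _ _ ⟨
      1# + 1# + 1# - 1#      ≈⟨ +-congʳ char3 ⟩
      0# - 1#                ≈⟨ +-identityˡ _ ⟩
      - 1#                   ∎

    -1-1≈1 : - 1# - 1# ≈ 1#
    -1-1≈1 = begin
      - 1# - 1#           ≈⟨ +-congʳ 1+1≈-1 ⟨
      1# + 1# - 1#        ≈⟨ +-assoc _ _ _ ⟩
      1# + (1# - 1#)      ≈⟨ +-congˡ (-‿inverseʳ 1#) ⟩
      1# + 0#             ≈⟨ +-identityʳ _ ⟩
      1#                  ∎

    embed-+ : ∀ a b → embed (a +₃ b) ≈ embed a + embed b
    embed-+ 0₃ b  = sym (+-identityˡ _)
    embed-+ 1₃ 0₃ = sym (+-identityʳ _)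
    embed-+ 1₃ 1₃ = sym 1+1≈-1
    embed-+ 1₃ 2₃ = sym (-‿inverseʳ 1#)
    embed-+ 2₃ 0₃ = sym (+-identityʳ _)
    embed-+ 2₃ 1₃ = sym (-‿inverseˡ 1#)
    embed-+ 2₃ 2₃ = sym -1-1≈1

    embed-- : ∀ a → embed (-₃ a) ≈ - embed a
    embed-- 0₃ = sym -0#≈0#
    embed-- 1₃ = refl
    embed-- 2₃ = sym (-‿involutive 1#)

    embed-* : ∀ a b → embed (a *₃ b) ≈ embed a * embed b
    embed-* 0₃ b = sym (zeroˡ _)
    embed-* 1₃ b = sym (*-identityˡ _)
    embed-* 2₃ b = trans (embed-- b) (trans (-‿cong (sym (*-identityˡ _))) (-‿distribˡ-* 1# (embed b)))

    -- Coefficients in F₃ let the solver cancel multiples of 3, so that it also decides identities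
    -- such as (1 + y)⁹ = 1 + y⁹.
    morphism : F₃-rawRing -Raw-AlmostCommutative⟶ fromCommutativeRing R
    morphism = record
      { ⟦_⟧ = embed ; +-homo = embed-+ ; *-homo = embed-* ; -‿homo = embed--
      ; 0-homo = refl ; 1-homo = refl }

    embed-≟ : (a b : F₃) → Maybe (embed a ≈ embed b)
    embed-≟ a b with a ≟₃ b
    ... | just ≡.refl = just refl
    ... | nothing     = nothing

  open Algebra.Solver.Ring F₃-rawRing (fromCommutativeRing R) morphism embed-≟ public
    using (Polynomial; con; solve; _:=_; _:+_; _:-_; _:*_; :-_; _:^_)

  :1 : ∀ {n} → Polynomial n
  :1 = con 1₃

  difference-zero : ∀ {a b} → a ≈ b → a - b ≈ 0#
  difference-zero {b = b} a≈b = trans (+-congʳ a≈b) (-‿inverseʳ b)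

  zero-difference : ∀ {a b} → a - b ≈ 0# → a ≈ b
  zero-difference {a} {b} e = begin
    a            ≈⟨ solve 2 (λ a b → a := (a :- b) :+ b) refl a b ⟩
    (a - b) + b  ≈⟨ +-congʳ e ⟩
    0# + b       ≈⟨ +-identityˡ b ⟩
    b            ∎

  times-zero : ∀ {a} b → a ≈ 0# → b * a ≈ 0#
  times-zero b e = trans (*-congˡ e) (zeroʳ b)

  -- Finite products and theta sums

  oddProduct : Carrier → ℕ → Carrier
  oddProduct x zero    = 1#
  oddProduct x (suc n) = (1# + x * (x * x) ^ n) * oddProduct x n

  -- The q-Pochhammer symbol (y; y)_n.
  eulerProduct : Carrier → ℕ → Carrier
  eulerProduct y zero    = 1#
  eulerProduct y (suc n) = (1# - y * y ^ n) * eulerProduct y n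

  squareSum : Carrier → ℕ → Carrier
  squareSum x zero    = 0#
  squareSum x (suc n) = squareSum x n + x ^ (suc n ℕ.* suc n)

  -- 1 + 2 Σ x^{j²}, since 2 = -1 in characteristic 3.
  thetaSum : Carrier → ℕ → Carrier
  thetaSum x n = 1# - squareSum x n

  -- Jacobi's triple product at z = 1, from its finite form
  -- ∏_{k≤n} (1 + x^{2k-1})² = Σ_{|j|≤n} x^{j²} [2n choose n+j], with binomials in base x².
  module TripleProduct (x : Carrier) where

    Q : Carrier
    Q = x * x

    -- binom n j is the Gaussian binomial [2n choose n+j] in base Q. The recursion is multiplication by
    -- (1 + z x^{2n+1})(1 + z⁻¹ x^{2n+1}); at j = 0 symmetry in j gives a coefficient 2 = -1.
    binom : ℕ → ℕ → Carrier
    binom zero    zero    = 1#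
    binom zero    (suc j) = 0#
    binom (suc n) zero    =
      (1# + Q * (Q ^ n * Q ^ n)) * binom n 0 - Q * Q ^ n * binom n 1
    binom (suc n) (suc j) =
      (1# + Q * (Q ^ n * Q ^ n)) * binom n (suc j) + Q ^ (n ∸ j) * binom n j
      + Q * Q * Q ^ n * Q ^ j * binom n (suc (suc j))

    binom-vanish : ∀ n j → n < j → binom n j ≈ 0#
    binom-vanish zero    (suc j) _ = refl
    binom-vanish (suc n) (suc j) (s≤s n<j) = begin
      u * binom n (suc j) + v * binom n j + w * binom n (suc (suc j))
        ≈⟨ +-cong (+-cong (times-zero u (binom-vanish n _ (ℕₚ.m≤n⇒m≤1+n n<j)))
                          (times-zero v (binom-vanish n _ n<j)))
                  (times-zero w (binom-vanish n _ (ℕₚ.m≤n⇒m≤1+n (ℕₚ.m≤n⇒m≤1+n n<j)))) ⟩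
      0# + 0# + 0#
        ≈⟨ trans (+-identityʳ _) (+-identityʳ _) ⟩
      0# ∎
      where
      u = 1# + Q * (Q ^ n * Q ^ n)
      v = Q ^ (n ∸ j)
      w = Q * Q * Q ^ n * Q ^ j

    private
      -- The quotient (1 - Q^(n-j)) / (1 - Q^(n+j+1)) of neighbouring Gaussian binomials,
      -- cross-multiplied. It ties the recursive `binom` to the product formula without any
      -- division.
      BinomRatio : ℕ → ℕ → Set ℓ
      BinomRatio n j =
        (1# - Q * Q ^ n * Q ^ j) * binom n (suc j) ≈ (1# - Q ^ (n ∸ j)) * binom n j

      -- BinomRatio n (suc j) multiplied by a power of Q, which removes the truncated subtraction.
      scaled-ratio : ∀ n j → BinomRatio n (suc j) →
        (1# - Q * Q * Q ^ n * Q ^ j) * (Q * Q * Q ^ n * Q ^ j * binom n (suc (suc j)))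
        ≈ (Q * Q * Q ^ n * Q ^ j - Q * (Q ^ n * Q ^ n)) * binom n (suc j)
      scaled-ratio n j ratio with suc j ℕₚ.≤? n
      ... | no  1+j≰n = trans
              (times-zero _ (times-zero _ (binom-vanish n _ (ℕₚ.m≤n⇒m≤1+n n<1+j))))
              (sym (times-zero _ (binom-vanish n _ n<1+j)))
        where n<1+j = ℕₚ.≰⇒> 1+j≰n
      ... | yes 1+j≤n = begin
        (1# - Q * Q * N * J) * (Q * Q * N * J * g₂)
          ≈⟨ solve 4 (λ Q N J g₂ → (:1 :- Q :* Q :* N :* J) :* (Q :* Q :* N :* J :* g₂)
                        := Q :* Q :* N :* J :* ((:1 :- Q :* N :* (Q :* J)) :* g₂)) refl Q N J g₂ ⟩
        Q * Q * N * J * ((1# - Q * N * (Q * J)) * g₂)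
          ≈⟨ *-congˡ ratio ⟩
        Q * Q * N * J * ((1# - D) * g₁)
          ≈⟨ solve 5 (λ Q N J D g₁ → Q :* Q :* N :* J :* ((:1 :- D) :* g₁)
                        := (Q :* Q :* N :* J :- Q :* (N :* (D :* (Q :* J)))) :* g₁) refl Q N J D g₁ ⟩
        (Q * Q * N * J - Q * (N * (D * (Q * J)))) * g₁
          ≈⟨ *-congʳ (+-congˡ (-‿cong (*-congˡ (*-congˡ D*QJ≈N)))) ⟩
        (Q * Q * N * J - Q * (N * N)) * g₁ ∎
        where
        N = Q ^ n
        J = Q ^ j
        D = Q ^ (n ∸ suc j)
        g₁ = binom n (suc j)
        g₂ = binom n (suc (suc j))
        D*QJ≈N : D * (Q * J) ≈ N
        D*QJ≈N = begin
          D * Q ^ suc j          ≈⟨ ^-homo-* Q (n ∸ suc j) (suc j) ⟨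
          Q ^ (n ∸ suc j ℕ.+ suc j) ≡⟨ cong (Q ^_) (ℕₚ.m∸n+n≡m 1+j≤n) ⟩
          N                      ∎

      -- Closes certificates: the solver writes the difference of the two sides of a goal as a
      -- combination of differences already known to vanish.
      combination₂ : ∀ {p p′ q q′} u v → p ≈ p′ → q ≈ q′ →
        u * (p - p′) + v * (q - q′) ≈ 0#
      combination₂ u v p≈p′ q≈q′ = trans
        (+-cong (times-zero u (difference-zero p≈p′)) (times-zero v (difference-zero q≈q′)))
        (+-identityʳ 0#)

      -- The case j = i + 1 ≤ n of the induction, where n - j = m.
      ratio-step : ∀ i m {n} → suc i ℕ.+ m ≡ n →
        BinomRatio n i → BinomRatio n (suc i) → BinomRatio n (suc (suc i)) → BinomRatio (suc n) (suc i)
      ratio-step i m ≡.refl r₀ r₁ r₂ = ≡.subst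
        (λ e → (1# - Q * (Q * N) * (Q * I)) * binom (suc n) (suc (suc i)) ≈ (1# - Q ^ e) * binom (suc n) (suc i))
        (≡.sym n∸i) (unfolded _ _ n∸1+i n∸i)
        where
        n = suc i ℕ.+ m
        N = Q ^ n
        M = Q ^ m
        I = Q ^ i
        g₀ = binom n i
        g₁ = binom n (suc i)
        g₂ = binom n (suc (suc i))
        g₃ = binom n (suc (suc (suc i)))
        n∸i : n ∸ i ≡ suc m
        n∸i = ≡.trans (cong (_∸ i) (≡.sym (ℕₚ.+-suc i m))) (ℕₚ.m+n∸m≡n i (suc m))
        n∸1+i : n ∸ suc i ≡ m
        n∸1+i = ℕₚ.m+n∸m≡n i m
        ratio₀ : (1# - Q * N * I) * g₁ ≈ (1# - Q * M) * g₀
        ratio₀ = ≡.subst (λ e → (1# - Q * N * I) * g₁ ≈ (1# - Q ^ e) * g₀) n∸i r₀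
        ratio₁ : (1# - Q * N * (Q * I)) * g₂ ≈ (1# - M) * g₁
        ratio₁ = ≡.subst (λ e → (1# - Q * N * (Q * I)) * g₂ ≈ (1# - Q ^ e) * g₁) n∸1+i r₁
        -- The truncated exponents that the recursion produces are generalised to `d` and `e`, so
        -- that they can be replaced by m and m + 1.
        unfolded : ∀ d e → d ≡ m → e ≡ suc m →
          (1# - Q * (Q * N) * (Q * I))
            * ((1# + Q * (N * N)) * g₂ + Q ^ d * g₁ + Q * Q * N * (Q * I) * g₃)
          ≈ (1# - Q * M) * ((1# + Q * (N * N)) * g₁ + Q ^ e * g₀ + Q * Q * N * I * g₂)
        -- The certificate uses the three ratios at `n`, the last one in scaled form, and the
        -- relation N = Q^(i+1) Q^m.
        unfolded _ _ ≡.refl ≡.refl = zero-difference (trans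
          (solve 8 (λ Q N M I g₀ g₁ g₂ g₃ →
            (:1 :- Q :* (Q :* N) :* (Q :* I))
              :* ((:1 :+ Q :* (N :* N)) :* g₂ :+ M :* g₁ :+ Q :* Q :* N :* (Q :* I) :* g₃)
            :- (:1 :- Q :* M) :* ((:1 :+ Q :* (N :* N)) :* g₁ :+ Q :* M :* g₀ :+ Q :* Q :* N :* I :* g₂)
            := (:1 :* ((:1 :- Q :* Q :* N :* (Q :* I)) :* (Q :* Q :* N :* (Q :* I) :* g₃)
                       :- (Q :* Q :* N :* (Q :* I) :- Q :* (N :* N)) :* g₂)
                :+ (:1 :+ Q :* Q :* N :* N) :* ((:1 :- Q :* N :* (Q :* I)) :* g₂ :- (:1 :- M) :* g₁))
               :+ (Q :* M :* ((:1 :- Q :* N :* I) :* g₁ :- (:1 :- Q :* M) :* g₀)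
                   :+ (Q :* Q :* N :* g₁ :- Q :* N :* g₁ :- Q :* Q :* N :* g₂) :* (N :- Q :* I :* M)))
            refl Q N M I g₀ g₁ g₂ g₃)
          (trans (+-cong (combination₂ _ _ (scaled-ratio n (suc i) r₂) ratio₁)
                         (combination₂ _ _ ratio₀ (^-homo-* Q (suc i) m)))
                 (+-identityʳ 0#)))

    binom-ratio : ∀ n j → BinomRatio n j
    binom-ratio zero zero = solve 1 (λ y → (:1 :- y :* :1 :* :1) :* con 0₃ := (:1 :- :1) :* :1) refl Q
    binom-ratio zero (suc j) = trans (zeroʳ _) (sym (zeroʳ _))
    binom-ratio (suc n) zero = zero-difference (trans
      (solve 5 (λ Q a g₀ g₁ g₂ →
        (:1 :- Q :* (Q :* a) :* :1) :* ((:1 :+ Q :* (a :* a)) :* g₁ :+ a :* g₀ :+ Q :* Q :* a :* :1 :* g₂)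
        :- (:1 :- Q :* a) :* ((:1 :+ Q :* (a :* a)) :* g₀ :- Q :* a :* g₁)
        := :1 :* ((:1 :- Q :* Q :* a :* :1) :* (Q :* Q :* a :* :1 :* g₂) :- (Q :* Q :* a :* :1 :- Q :* (a :* a)) :* g₁)
           :+ (:1 :- Q :* a :+ Q :* Q :* a :* a) :* ((:1 :- Q :* a :* :1) :* g₁ :- (:1 :- a) :* g₀))
        refl Q (Q ^ n) (binom n 0) (binom n 1) (binom n 2))
      (combination₂ _ _ (scaled-ratio n 0 (binom-ratio n 1)) (binom-ratio n 0)))
    binom-ratio (suc n) (suc i) with suc i ℕₚ.≤? n
    -- For n ≤ i the left binomial vanishes, and so does the right coefficient 1 - Q^0, the
    -- subtraction being truncated.
    ... | no 1+i≰n = trans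
            (times-zero _ (binom-vanish (suc n) (suc (suc i)) (s≤s n<1+i)))
            (sym (trans (*-congʳ 1-Q^0≈0) (zeroˡ _)))
      where
      n<1+i = ℕₚ.≰⇒> 1+i≰n
      1-Q^0≈0 : 1# - Q ^ (n ∸ i) ≈ 0#
      1-Q^0≈0 rewrite ℕₚ.m≤n⇒m∸n≡0 (ℕ.s≤s⁻¹ n<1+i) = -‿inverseʳ 1#
    ... | yes 1+i≤n with ℕₚ.m≤n⇒∃[o]m+o≡n 1+i≤n
    ...   | m , eq = ratio-step i m eq (binom-ratio n i) (binom-ratio n (suc i)) (binom-ratio n (suc (suc i)))

    -- Only positive j: the terms of j and -j agree, so the sum over |j| ≤ n is `binom n 0` plus
    -- twice this sum, that is, minus it.
    binomSum : ℕ → ℕ → Carrier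
    binomSum n zero    = 0#
    binomSum n (suc k) = binomSum n k + x ^ (suc k ℕ.* suc k) * binom n (suc k)

    private
      term : ℕ → ℕ → Carrier
      term n j = x ^ (j ℕ.* j) * binom n j

      Q^n≈x^[n+n] : ∀ n → Q ^ n ≈ x ^ n * x ^ n
      Q^n≈x^[n+n] n = ^-distrib-* x x n

      -- (j + 1)² + 2 (n - j) = (2 n + 1) + j².
      lower-exponent : ∀ n j → j ≤ n →
        x ^ (suc j ℕ.* suc j) * Q ^ (n ∸ j) ≈ x * Q ^ n * x ^ (j ℕ.* j)
      lower-exponent n j j≤n = begin
        x ^ (suc j ℕ.* suc j) * Q ^ (n ∸ j)
          ≡⟨ cong (λ e → x ^ e * Q ^ (n ∸ j)) (cong suc (cong (j ℕ.+_) (ℕₚ.*-suc j j))) ⟩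
        x * x ^ (j ℕ.+ (j ℕ.+ j ℕ.* j)) * Q ^ (n ∸ j)
          ≈⟨ *-congʳ (*-congˡ (trans (^-homo-* x j _) (*-congˡ (^-homo-* x j _)))) ⟩
        x * (x ^ j * (x ^ j * x ^ (j ℕ.* j))) * Q ^ (n ∸ j)
          ≈⟨ solve 4 (λ x a b d → x :* (a :* (a :* b)) :* d := x :* (d :* (a :* a)) :* b)
               refl x (x ^ j) (x ^ (j ℕ.* j)) (Q ^ (n ∸ j)) ⟩
        x * (Q ^ (n ∸ j) * (x ^ j * x ^ j)) * x ^ (j ℕ.* j)
          ≈⟨ *-congʳ (*-congˡ (*-congˡ (sym (Q^n≈x^[n+n] j)))) ⟩
        x * (Q ^ (n ∸ j) * Q ^ j) * x ^ (j ℕ.* j)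
          ≈⟨ *-congʳ (*-congˡ (sym (^-homo-* Q (n ∸ j) j))) ⟩
        x * Q ^ (n ∸ j ℕ.+ j) * x ^ (j ℕ.* j)
          ≡⟨ cong (λ e → x * Q ^ e * x ^ (j ℕ.* j)) (ℕₚ.m∸n+n≡m j≤n) ⟩
        x * Q ^ n * x ^ (j ℕ.* j) ∎

      -- j² + 2 (n + j + 1) = (2 n + 1) + (j + 1)².
      upper-exponent : ∀ n j →
        x ^ (j ℕ.* j) * (Q * Q ^ n * Q ^ j) ≈ x * Q ^ n * x ^ (suc j ℕ.* suc j)
      upper-exponent n j = begin
        x ^ (j ℕ.* j) * (Q * Q ^ n * Q ^ j)
          ≈⟨ *-congˡ (*-congˡ (Q^n≈x^[n+n] j)) ⟩
        x ^ (j ℕ.* j) * (Q * Q ^ n * (x ^ j * x ^ j))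
          ≈⟨ solve 4 (λ x a b d → b :* (x :* x :* d :* (a :* a)) := x :* d :* (x :* (a :* (a :* b))))
               refl x (x ^ j) (x ^ (j ℕ.* j)) (Q ^ n) ⟩
        x * Q ^ n * (x * (x ^ j * (x ^ j * x ^ (j ℕ.* j))))
          ≈⟨ *-congˡ (*-congˡ (sym (trans (^-homo-* x j _) (*-congˡ (^-homo-* x j _))))) ⟩
        x * Q ^ n * (x * x ^ (j ℕ.+ (j ℕ.+ j ℕ.* j)))
          ≡⟨ cong (λ e → x * Q ^ n * x ^ suc (j ℕ.+ e)) (ℕₚ.*-suc j j) ⟨
        x * Q ^ n * x ^ (suc j ℕ.* suc j) ∎

      -- `term n j` is the coefficient of z^j in the product of the (1 + z x^(2k-1))(1 + z⁻¹
      -- x^(2k-1)). The next factor is 1 + y² + y (z + z⁻¹) with y = x^(2n+1), and this compares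
      -- coefficients of z^(j+1).
      term-step : ∀ n j → j ≤ n → let y = x * Q ^ n in
        term (suc n) (suc j) ≈ (1# + y * y) * term n (suc j) + y * (term n j + term n (suc (suc j)))
      term-step n j j≤n = begin
        s * ((1# + Q * (N * N)) * g₁ + D * g₀ + Q * Q * N * J * g₂)
          ≈⟨ solve 8 (λ x s N D J g₀ g₁ g₂ →
               s :* ((:1 :+ x :* x :* (N :* N)) :* g₁ :+ D :* g₀ :+ x :* x :* (x :* x) :* N :* J :* g₂)
               := (:1 :+ x :* N :* (x :* N)) :* (s :* g₁)
                  :+ (s :* D :* g₀ :+ s :* (x :* x :* N :* (x :* x :* J)) :* g₂))
               refl x s N D J g₀ g₁ g₂ ⟩
        (1# + x * N * (x * N)) * (s * g₁) + (s * D * g₀ + s * (Q * N * (Q * J)) * g₂)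
          ≈⟨ +-congˡ (+-cong (*-congʳ (lower-exponent n j j≤n)) (*-congʳ (upper-exponent n (suc j)))) ⟩
        (1# + x * N * (x * N)) * (s * g₁) + (x * N * a * g₀ + x * N * b * g₂)
          ≈⟨ +-congˡ (trans (+-cong (*-assoc _ _ _) (*-assoc _ _ _)) (sym (distribˡ _ _ _))) ⟩
        (1# + x * N * (x * N)) * (s * g₁) + x * N * (a * g₀ + b * g₂) ∎
        where
        s = x ^ (suc j ℕ.* suc j)
        a = x ^ (j ℕ.* j)
        b = x ^ (suc (suc j) ℕ.* suc (suc j))
        N = Q ^ n
        D = Q ^ (n ∸ j)
        J = Q ^ j
        g₀ = binom n j
        g₁ = binom n (suc j)
        g₂ = binom n (suc (suc j))

      -- `term-step` summed over j: the lower neighbours give the sum with the term of 0 added, the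
      -- upper ones the sum with the term of 1 removed.
      binomSum-step : ∀ n k → k ≤ n → let y = x * Q ^ n in
        binomSum (suc n) (suc k) ≈
          (1# + y * y) * binomSum n (suc k)
          + y * (term n 0 + binomSum n k + binomSum n (suc (suc k)) - term n 1)
      binomSum-step n zero _ = trans (+-congˡ (term-step n 0 z≤n))
        (solve 4 (λ y t₀ t₁ t₂ →
          con 0₃ :+ ((:1 :+ y :* y) :* t₁ :+ y :* (t₀ :+ t₂))
          := (:1 :+ y :* y) :* (con 0₃ :+ t₁) :+ y :* (t₀ :+ con 0₃ :+ (con 0₃ :+ t₁ :+ t₂) :- t₁))
          refl (x * Q ^ n) (term n 0) (term n 1) (term n 2))
      binomSum-step n (suc k) 1+k≤n = trans
        (+-cong (binomSum-step n k (ℕₚ.≤-trans (ℕₚ.n≤1+n k) 1+k≤n)) (term-step n (suc k) 1+k≤n))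
        (solve 7 (λ y t₀ t₁ s u v w →
          ((:1 :+ y :* y) :* (s :+ u) :+ y :* (t₀ :+ s :+ (s :+ u :+ v) :- t₁))
          :+ ((:1 :+ y :* y) :* v :+ y :* (u :+ w))
          := (:1 :+ y :* y) :* (s :+ u :+ v) :+ y :* (t₀ :+ (s :+ u) :+ (s :+ u :+ v :+ w) :- t₁))
          refl (x * Q ^ n) (term n 0) (term n 1) (binomSum n k) (term n (suc k)) (term n (suc (suc k)))
          (term n (suc (suc (suc k)))))

      binomSum-stable : ∀ n k → n ≤ k → binomSum n (suc k) ≈ binomSum n k
      binomSum-stable n k n≤k =
        trans (+-congˡ (times-zero _ (binom-vanish n (suc k) (s≤s n≤k)))) (+-identityʳ _)

    oddProduct²≈binomSum : ∀ n → oddProduct x n * oddProduct x n ≈ binom n 0 - binomSum n n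
    oddProduct²≈binomSum zero = solve 0 (:1 :* :1 := :1 :- con 0₃) refl
    oddProduct²≈binomSum (suc n) = sym (begin
      binom (suc n) 0 - binomSum (suc n) (suc n)
        ≈⟨ +-congˡ (-‿cong (binomSum-step n n ℕₚ.≤-refl)) ⟩
      binom (suc n) 0 - ((1# + y * y) * binomSum n (suc n)
        + y * (term n 0 + binomSum n n + binomSum n (suc (suc n)) - term n 1))
        ≈⟨ +-congˡ (-‿cong (+-cong (*-congˡ stable) (*-congˡ (+-congʳ (+-congˡ
             (trans (binomSum-stable n (suc n) (ℕₚ.n≤1+n n)) stable)))))) ⟩
      binom (suc n) 0 - ((1# + y * y) * binomSum n n
        + y * (term n 0 + binomSum n n + binomSum n n - term n 1))
        ≈⟨ solve 5 (λ x N g₀ g₁ s →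
             ((:1 :+ x :* x :* (N :* N)) :* g₀ :- x :* x :* N :* g₁)
             :- ((:1 :+ x :* N :* (x :* N)) :* s :+ x :* N :* (:1 :* g₀ :+ s :+ s :- x :* :1 :* g₁))
             := (:1 :+ x :* N) :* (:1 :+ x :* N) :* (g₀ :- s))
             refl x (Q ^ n) (binom n 0) (binom n 1) (binomSum n n) ⟩
      (1# + y) * (1# + y) * (binom n 0 - binomSum n n)
        ≈⟨ *-congˡ (oddProduct²≈binomSum n) ⟨
      (1# + y) * (1# + y) * (oddProduct x n * oddProduct x n)
        ≈⟨ solve 2 (λ a b → a :* a :* (b :* b) := a :* b :* (a :* b)) refl (1# + y) (oddProduct x n) ⟩
      (1# + y) * oddProduct x n * ((1# + y) * oddProduct x n) ∎)
      where
      y = x * Q ^ n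
      stable = binomSum-stable n n ℕₚ.≤-refl

    -- The product formula for the binomial [2n choose n], cross-multiplied. In the induction step
    -- `binom n 1` is eliminated by the ratio at j = 0.
    binom-central : ∀ n →
      eulerProduct Q n * (eulerProduct Q n * binom n 0) ≈ eulerProduct Q (n ℕ.+ n)
    binom-central zero = solve 0 (:1 :* (:1 :* :1) := :1) refl
    binom-central (suc n) rewrite ℕₚ.+-suc n n = zero-difference (begin
      (1# - Q * a) * E * ((1# - Q * a) * E * ((1# + Q * (a * a)) * g₀ - Q * a * g₁))
      - (1# - Q * (Q * Q ^ (n ℕ.+ n))) * ((1# - Q * Q ^ (n ℕ.+ n)) * E₂)
        ≈⟨ +-congˡ (-‿cong (*-cong (+-congˡ (-‿cong (*-congˡ (*-congˡ a²))))
                                   (*-congʳ (+-congˡ (-‿cong (*-congˡ a²)))))) ⟩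
      (1# - Q * a) * E * ((1# - Q * a) * E * ((1# + Q * (a * a)) * g₀ - Q * a * g₁))
      - (1# - Q * (Q * (a * a))) * ((1# - Q * (a * a)) * E₂)
        ≈⟨ solve 6 (λ Q a E E₂ g₀ g₁ →
             (:1 :- Q :* a) :* E :* ((:1 :- Q :* a) :* E :* ((:1 :+ Q :* (a :* a)) :* g₀ :- Q :* a :* g₁))
             :- (:1 :- Q :* (Q :* (a :* a))) :* ((:1 :- Q :* (a :* a)) :* E₂)
             := (con 2₃ :* (Q :* a :* (:1 :- Q :* a) :* E :* E)) :* ((:1 :- Q :* a :* :1) :* g₁ :- (:1 :- a) :* g₀)
                :+ ((:1 :- Q :* a) :* (:1 :+ Q :* a) :* (:1 :- Q :* (a :* a))) :* (E :* (E :* g₀) :- E₂))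
             refl Q a E E₂ g₀ g₁ ⟩
      (- 1# * (Q * a * (1# - Q * a) * E * E)) * ((1# - Q * a * 1#) * g₁ - (1# - a) * g₀)
      + ((1# - Q * a) * (1# + Q * a) * (1# - Q * (a * a))) * (E * (E * g₀) - E₂)
        ≈⟨ combination₂ _ _ (binom-ratio n 0) (binom-central n) ⟩
      0# ∎)
      where
      a = Q ^ n
      E = eulerProduct Q n
      E₂ = eulerProduct Q (n ℕ.+ n)
      g₀ = binom n 0
      g₁ = binom n 1
      a² = ^-homo-* Q n n

    -- A nilpotent `x` stands for q modulo q^K: finite products become stationary, and error terms
    -- of high order are zero.
    module Truncated {K : ℕ} (x^K≈0 : x ^ K ≈ 0#) where

      power-zero : ∀ {k} → K ≤ k → x ^ k ≈ 0#
      power-zero {k} K≤k = begin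
        x ^ k                   ≡⟨ cong (x ^_) (ℕₚ.m∸n+n≡m K≤k) ⟨
        x ^ (k ∸ K ℕ.+ K)       ≈⟨ ^-homo-* x (k ∸ K) K ⟩
        x ^ (k ∸ K) * x ^ K     ≈⟨ times-zero _ x^K≈0 ⟩
        0#                      ∎

      mixed-power-zero : ∀ i m → K ≤ i ℕ.+ (m ℕ.+ m) → x ^ i * Q ^ m ≈ 0#
      mixed-power-zero i m K≤ = begin
        x ^ i * Q ^ m              ≈⟨ *-congˡ (Q^n≈x^[n+n] m) ⟩
        x ^ i * (x ^ m * x ^ m)    ≈⟨ *-congˡ (^-homo-* x m m) ⟨
        x ^ i * x ^ (m ℕ.+ m)      ≈⟨ ^-homo-* x i (m ℕ.+ m) ⟨
        x ^ (i ℕ.+ (m ℕ.+ m))      ≈⟨ power-zero K≤ ⟩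
        0#                         ∎

      Q^-zero : ∀ {n} → K ≤ n ℕ.+ n → Q ^ n ≈ 0#
      Q^-zero {n} K≤ = trans (sym (*-identityˡ _)) (mixed-power-zero 0 n K≤)

      -- The hypothesis says y = x u y; iterating it K times puts the factor x^K = 0 into y.
      cancel-unit : ∀ u y → (1# - x * u) * y ≈ 0# → y ≈ 0#
      cancel-unit u y e = trans (iterate K)
        (trans (*-congʳ x^K≈0) (zeroˡ _))
        where
        fixed : y ≈ x * u * y
        fixed = begin
          y                            ≈⟨ solve 2 (λ a y → y := (:1 :- a) :* y :+ a :* y) refl (x * u) y ⟩
          (1# - x * u) * y + x * u * y ≈⟨ +-congʳ e ⟩
          0# + x * u * y               ≈⟨ +-identityˡ _ ⟩
          x * u * y                    ∎
        iterate : ∀ k → y ≈ x ^ k * (u ^ k * y)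
        iterate zero    = sym (trans (*-identityˡ _) (*-identityˡ _))
        iterate (suc k) = begin
          y                                ≈⟨ iterate k ⟩
          x ^ k * (u ^ k * y)              ≈⟨ *-congˡ (*-congˡ fixed) ⟩
          x ^ k * (u ^ k * (x * u * y))
            ≈⟨ solve 5 (λ a b x u y → a :* (b :* (x :* u :* y)) := x :* a :* (u :* b :* y)) refl (x ^ k) (u ^ k) x u y ⟩
          x ^ suc k * (u ^ suc k * y)      ∎

      eulerProduct-cancel : ∀ n y → eulerProduct Q n * y ≈ 0# → y ≈ 0#
      eulerProduct-cancel zero    y e = trans (sym (*-identityˡ y)) e
      eulerProduct-cancel (suc n) y e = eulerProduct-cancel n y (cancel-unit (x * Q ^ n) _ (begin
        (1# - x * (x * Q ^ n)) * (eulerProduct Q n * y)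
          ≈⟨ solve 4 (λ x a b y → (:1 :- x :* (x :* a)) :* (b :* y) := (:1 :- x :* x :* a) :* b :* y)
               refl x (Q ^ n) (eulerProduct Q n) y ⟩
        (1# - Q * Q ^ n) * eulerProduct Q n * y ≈⟨ e ⟩
        0# ∎))

      module _ {n : ℕ} (K≤2n : K ≤ n ℕ.+ n) where

        eulerProduct-stable : ∀ i → eulerProduct Q (i ℕ.+ n) ≈ eulerProduct Q n
        eulerProduct-stable zero    = refl
        eulerProduct-stable (suc i) = begin
          (1# - Q * Q ^ (i ℕ.+ n)) * eulerProduct Q (i ℕ.+ n)
            ≈⟨ *-cong (+-congˡ (-‿cong (*-congˡ (^-homo-* Q i n)))) (eulerProduct-stable i) ⟩
          (1# - Q * (Q ^ i * Q ^ n)) * eulerProduct Q n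
            ≈⟨ *-congʳ (+-congˡ (-‿cong (times-zero _ (times-zero _ (Q^-zero {n} K≤2n))))) ⟩
          (1# - 0#) * eulerProduct Q n
            ≈⟨ solve 1 (λ a → (:1 :- con 0₃) :* a := a) refl (eulerProduct Q n) ⟩
          eulerProduct Q n ∎

        -- (Q; Q)_n [2n choose n+j] = 1 + O(Q^{n-j}); the factor x^i absorbs the error term.
        binom-limit : ∀ j → j ≤ n → ∀ i → K ≤ i ℕ.+ ((n ∸ j) ℕ.+ (n ∸ j)) →
          x ^ i * (eulerProduct Q n * binom n j) ≈ x ^ i
        binom-limit zero _ i _ = trans (*-congˡ (zero-difference (eulerProduct-cancel n _ (begin
          E * (E * g₀ - 1#)    ≈⟨ solve 2 (λ E g₀ → E :* (E :* g₀ :- :1) := E :* (E :* g₀) :- E) refl E g₀ ⟩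
          E * (E * g₀) - E     ≈⟨ difference-zero (trans (binom-central n) (eulerProduct-stable n)) ⟩
          0#                   ∎)))) (*-identityʳ _)
          where
          E = eulerProduct Q n
          g₀ = binom n 0
        binom-limit (suc j) 1+j≤n i K≤ = zero-difference (begin
          p * (E * g₁) - p
            ≈⟨ solve 8 (λ p E Q N J D g₀ g₁ → p :* (E :* g₁) :- p
                 := (p :* E :* ((:1 :- Q :* N :* J) :* g₁ :- (:1 :- D) :* g₀) :+ :1 :* (p :* (E :* g₀) :- p))
                    :+ (p :* E :* Q :* J :* g₁ :* N :- E :* g₀ :* (p :* D)))
                 refl p E Q (Q ^ n) (Q ^ j) (Q ^ (n ∸ j)) g₀ g₁ ⟩
          (p * E * ((1# - Q * Q ^ n * Q ^ j) * g₁ - (1# - Q ^ (n ∸ j)) * g₀) + 1# * (p * (E * g₀) - p))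
          + (p * E * Q * Q ^ j * g₁ * Q ^ n - E * g₀ * (p * Q ^ (n ∸ j)))
            ≈⟨ +-cong (combination₂ _ _ (binom-ratio n j) (binom-limit j (ℕₚ.<⇒≤ 1+j≤n) i K≤′))
                      (+-cong (times-zero _ (Q^-zero {n} K≤2n)) (-‿cong (times-zero _ (mixed-power-zero i (n ∸ j) K≤′)))) ⟩
          0# + (0# - 0#)
            ≈⟨ solve 0 (con 0₃ :+ (con 0₃ :- con 0₃) := con 0₃) refl ⟩
          0# ∎)
          where
          p = x ^ i
          E = eulerProduct Q n
          g₀ = binom n j
          g₁ = binom n (suc j)
          shrink = ℕₚ.∸-monoʳ-≤ n (ℕₚ.n≤1+n j)
          K≤′ = ℕₚ.≤-trans K≤ (ℕₚ.+-monoʳ-≤ i (ℕₚ.+-mono-≤ shrink shrink))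

      private
        -- From (j - 1)² ≥ 0. At j = 1 the right side is 2 n - 1, whence the strict inequality K < 2
        -- n.
        exponent-bound : ∀ {n} j → K < n ℕ.+ n → j ≤ n → K ≤ j ℕ.* j ℕ.+ ((n ∸ j) ℕ.+ (n ∸ j))
        exponent-bound {n} j K<2n j≤n with ℕₚ.m≤n⇒∃[o]m+o≡n j≤n
        ... | o , ≡.refl rewrite ℕₚ.m+n∸m≡n j o = ℕ.s≤s⁻¹ (ℕₚ.≤-trans K<2n (ℕₚ.≤-trans
          (ℕₚ.≤-reflexive (exchange j o)) (ℕₚ.+-monoˡ-≤ (o ℕ.+ o) (2j≤1+j² j))))
          where
          exchange : ∀ j o → (j ℕ.+ o) ℕ.+ (j ℕ.+ o) ≡ (j ℕ.+ j) ℕ.+ (o ℕ.+ o)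
          exchange = solve-∀
          2j≤1+j² : ∀ j → j ℕ.+ j ≤ suc (j ℕ.* j)
          2j≤1+j² zero    = z≤n
          2j≤1+j² (suc j) = s≤s (ℕₚ.≤-trans (ℕₚ.≤-reflexive (ℕₚ.+-suc j j))
            (s≤s (ℕₚ.+-monoʳ-≤ j (ℕₚ.m≤m*n j (suc j)))))

      -- Multiplication by (Q; Q)_n turns every binomial of the finite triple product into 1 up to
      -- an error of order Q^(n-j), and the factor x^(j²) lifts this error to order at least K.
      gauss : ∀ n → K < n ℕ.+ n →
        oddProduct x n * oddProduct x n * eulerProduct Q n ≈ thetaSum x n
      gauss n K<2n = begin
        oddProduct x n * oddProduct x n * E     ≈⟨ *-congʳ (oddProduct²≈binomSum n) ⟩
        (binom n 0 - binomSum n n) * E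
          ≈⟨ solve 3 (λ a b E → (a :- b) :* E := :1 :* (E :* a) :- E :* b) refl (binom n 0) (binomSum n n) E ⟩
        1# * (E * binom n 0) - E * binomSum n n
          ≈⟨ +-cong (binom-limit {n} K≤2n 0 z≤n 0 K≤2n) (-‿cong (partial n ℕₚ.≤-refl)) ⟩
        1# - squareSum x n                      ∎
        where
        K≤2n = ℕₚ.<⇒≤ K<2n
        E = eulerProduct Q n
        partial : ∀ k → k ≤ n → E * binomSum n k ≈ squareSum x k
        partial zero    _     = zeroʳ E
        partial (suc k) 1+k≤n = begin
          E * (binomSum n k + s * binom n (suc k))
            ≈⟨ solve 4 (λ E a s b → E :* (a :+ s :* b) := E :* a :+ s :* (E :* b))
                 refl E (binomSum n k) s (binom n (suc k)) ⟩
          E * binomSum n k + s * (E * binom n (suc k))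
            ≈⟨ +-cong (partial k (ℕₚ.<⇒≤ 1+k≤n))
                      (binom-limit {n} K≤2n (suc k) 1+k≤n (suc k ℕ.* suc k) (exponent-bound (suc k) K<2n 1+k≤n)) ⟩
          squareSum x k + s ∎
          where s = x ^ (suc k ℕ.* suc k)

  -- Product identities relating x, -x and -x²

  open TripleProduct.Truncated using (gauss; eulerProduct-stable)

  eulerProduct-cong : ∀ {x y} → x ≈ y → ∀ n → eulerProduct x n ≈ eulerProduct y n
  eulerProduct-cong x≈y zero    = refl
  eulerProduct-cong x≈y (suc n) =
    *-cong (+-congˡ (-‿cong (*-cong x≈y (^-congˡ n x≈y)))) (eulerProduct-cong x≈y n)

  neg-square : ∀ x → - x * - x ≈ x * x
  neg-square = solve 1 (λ x → :- x :* :- x := x :* x) refl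

  -- (1 + x^(2k-1))(1 - x^(2k-1)) = 1 + (-x²)^(2k-1), the exponent 2k - 1 being odd.
  oddProduct-neg : ∀ x n → oddProduct x n * oddProduct (- x) n ≈ oddProduct (- (x * x)) n
  oddProduct-neg x zero    = *-identityˡ 1#
  oddProduct-neg x (suc n) = begin
    (1# + x * (x * x) ^ n) * D⁺ * ((1# + - x * (- x * - x) ^ n) * D⁻)
      ≈⟨ *-congˡ (*-congʳ (+-congˡ (*-congˡ (^-congˡ n (neg-square x))))) ⟩
    (1# + x * (x * x) ^ n) * D⁺ * ((1# + - x * (x * x) ^ n) * D⁻)
      ≈⟨ solve 4 (λ x a b c → (:1 :+ x :* a) :* b :* ((:1 :+ :- x :* a) :* c)
           := (:1 :+ :- (x :* x) :* (a :* a)) :* (b :* c)) refl x ((x * x) ^ n) D⁺ D⁻ ⟩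
    (1# + - (x * x) * ((x * x) ^ n * (x * x) ^ n)) * (D⁺ * D⁻)
      ≈⟨ *-cong (+-congˡ (*-congˡ (trans (sym (^-distrib-* (x * x) (x * x) n)) (^-congˡ n (sym (neg-square (x * x)))))))
                (oddProduct-neg x n) ⟩
    (1# + - (x * x) * (- (x * x) * - (x * x)) ^ n) * oddProduct (- (x * x)) n ∎
    where
    D⁺ = oddProduct x n
    D⁻ = oddProduct (- x) n

  -- Separates odd from even exponents, with 1 - y^(2k-1) = 1 + (-y)^(2k-1).
  eulerProduct-split : ∀ y n →
    eulerProduct y (n ℕ.+ n) ≈ oddProduct (- y) n * eulerProduct (y * y) n
  eulerProduct-split y zero    = sym (*-identityˡ 1#)
  eulerProduct-split y (suc n) rewrite ℕₚ.+-suc n n = begin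
    (1# - y * (y * y ^ (n ℕ.+ n))) * ((1# - y * y ^ (n ℕ.+ n)) * eulerProduct y (n ℕ.+ n))
      ≈⟨ *-cong (+-congˡ (-‿cong (*-congˡ (*-congˡ halve))))
           (*-cong (+-congˡ (-‿cong (*-congˡ halve))) (eulerProduct-split y n)) ⟩
    (1# - y * (y * z)) * ((1# - y * z) * (D * E))
      ≈⟨ solve 4 (λ y z D E → (:1 :- y :* (y :* z)) :* ((:1 :- y :* z) :* (D :* E))
           := (:1 :+ :- y :* z) :* D :* ((:1 :- y :* y :* z) :* E)) refl y z D E ⟩
    (1# + - y * z) * D * ((1# - y * y * z) * E)
      ≈⟨ *-congʳ (*-congʳ (+-congˡ (*-congˡ (^-congˡ n (sym (neg-square y)))))) ⟩
    (1# + - y * (- y * - y) ^ n) * D * ((1# - y * y * z) * E) ∎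
    where
    z = (y * y) ^ n
    D = oddProduct (- y) n
    E = eulerProduct (y * y) n
    halve : y ^ (n ℕ.+ n) ≈ z
    halve = trans (^-homo-* y n n) (sym (^-distrib-* y y n))

  module _ {x : Carrier} {K : ℕ} (x^K≈0 : x ^ K ≈ 0#) where

    neg-power-zero : (- x) ^ K ≈ 0#
    neg-power-zero = begin
      (- x) ^ K         ≈⟨ ^-congˡ K (solve 1 (λ x → :- x := con 2₃ :* x) refl x) ⟩
      (- 1# * x) ^ K    ≈⟨ ^-distrib-* (- 1#) x K ⟩
      (- 1#) ^ K * x ^ K ≈⟨ times-zero _ x^K≈0 ⟩
      0#                ∎

    neg-square-power-zero : (- (x * x)) ^ K ≈ 0#
    neg-square-power-zero = begin
      (- (x * x)) ^ K      ≈⟨ ^-congˡ K (solve 1 (λ x → :- (x :* x) := :- x :* x) refl x) ⟩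
      (- x * x) ^ K        ≈⟨ ^-distrib-* (- x) x K ⟩
      (- x) ^ K * x ^ K    ≈⟨ times-zero _ x^K≈0 ⟩
      0#                   ∎

    module _ {n : ℕ} (K<2n : K < n ℕ.+ n) where

      gauss-neg : oddProduct (- x) n * oddProduct (- x) n * eulerProduct (x * x) n ≈ thetaSum (- x) n
      gauss-neg = trans (*-congˡ (eulerProduct-cong (sym (neg-square x)) n))
        (gauss (- x) neg-power-zero n K<2n)

      -- By `gauss` both sides are products. Here D⁺ D⁻ = D and E = D E₂, so (D⁺ D⁻)² E² = (D² E₂)².
      -- Splitting E needs 2 n factors instead of n, and the additional ones are 1.
      thetaSum-neg : thetaSum x n * thetaSum (- x) n ≈ thetaSum (- (x * x)) n * thetaSum (- (x * x)) n
      thetaSum-neg = begin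
        thetaSum x n * thetaSum (- x) n
          ≈⟨ *-cong (gauss x x^K≈0 n K<2n) gauss-neg ⟨
        D⁺ * D⁺ * E * (D⁻ * D⁻ * E)
          ≈⟨ solve 3 (λ a b c → a :* a :* c :* (b :* b :* c) := (a :* b) :* (a :* b) :* (c :* c)) refl D⁺ D⁻ E ⟩
        (D⁺ * D⁻) * (D⁺ * D⁻) * (E * E)
          ≈⟨ *-cong (*-cong (oddProduct-neg x n) (oddProduct-neg x n)) (*-cong E-split E-split) ⟩
        D * D * (D * E₂ * (D * E₂))
          ≈⟨ solve 2 (λ D E₂ → D :* D :* (D :* E₂ :* (D :* E₂)) := D :* D :* E₂ :* (D :* D :* E₂)) refl D E₂ ⟩
        D * D * E₂ * (D * D * E₂)
          ≈⟨ *-cong D²E₂ D²E₂ ⟩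
        thetaSum (- (x * x)) n * thetaSum (- (x * x)) n ∎
        where
        D⁺ = oddProduct x n
        D⁻ = oddProduct (- x) n
        E  = eulerProduct (x * x) n
        D  = oddProduct (- (x * x)) n
        E₂ = eulerProduct (x * x * (x * x)) n
        E-split : E ≈ D * E₂
        E-split = trans (sym (eulerProduct-stable x x^K≈0 {n} (ℕₚ.<⇒≤ K<2n) n)) (eulerProduct-split (x * x) n)
        D²E₂ : D * D * E₂ ≈ thetaSum (- (x * x)) n
        D²E₂ = trans (*-congˡ (eulerProduct-cong (sym (neg-square (x * x))) n))
          (gauss (- (x * x)) neg-square-power-zero n K<2n)

      -- With P = D⁺/D⁻, the quotient of the two theta functions is P², and s = P/P⁹ in characteristic 3.
      quotient-theta : ∀ {s} → s * oddProduct x n ^ 8 ≈ oddProduct (- x) n ^ 8 →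
        s * thetaSum x n ^ 4 ≈ thetaSum (- x) n ^ 4
      quotient-theta {s} s*D⁺⁸≈D⁻⁸ = begin
        s * thetaSum x n ^ 4
          ≈⟨ *-congˡ (^-congˡ 4 (gauss x x^K≈0 n K<2n)) ⟨
        s * (D⁺ * D⁺ * E) ^ 4
          ≈⟨ solve 3 (λ s d e → s :* (d :* d :* e) :^ 4 := s :* d :^ 8 :* e :^ 4) refl s D⁺ E ⟩
        s * D⁺ ^ 8 * E ^ 4
          ≈⟨ *-congʳ s*D⁺⁸≈D⁻⁸ ⟩
        D⁻ ^ 8 * E ^ 4
          ≈⟨ solve 2 (λ d e → d :^ 8 :* e :^ 4 := (d :* d :* e) :^ 4) refl D⁻ E ⟩
        (D⁻ * D⁻ * E) ^ 4
          ≈⟨ ^-congˡ 4 gauss-neg ⟩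
        thetaSum (- x) n ^ 4 ∎
        where
        D⁺ = oddProduct x n
        D⁻ = oddProduct (- x) n
        E  = eulerProduct (x * x) n

  cube-split : ∀ c x f → (c + x * f) ^ 3 ≈ c ^ 3 + x * (x * (x * f ^ 3))
  cube-split = solve 3 (λ c x f → (c :+ x :* f) :^ 3 := c :^ 3 :+ x :* (x :* (x :* f :^ 3))) refl

  -- With w = 1/(1 + y⁹) and z = 1/(1 - y), the relations 1 ± y⁹ = (1 ± y)⁹ turn a factor of the
  -- generating function into ((1 - y)/(1 + y))⁸.
  factor-cancel : ∀ y {w z} → (1# + y ^ 9) * w ≈ 1# → (1# - y) * z ≈ 1# →
    (1# + y) * ((1# - y ^ 9) * (w * z)) * (1# + y) ^ 8 ≈ (1# - y) ^ 8
  factor-cancel y {w} {z} p q = begin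
    (1# + y) * ((1# - y ^ 9) * (w * z)) * (1# + y) ^ 8
      ≈⟨ solve 3 (λ y w z → (:1 :+ y) :* ((:1 :- y :^ 9) :* (w :* z)) :* (:1 :+ y) :^ 8
           := ((:1 :+ y :^ 9) :* w) :* ((:1 :- y) :* z) :* (:1 :- y) :^ 8) refl y w z ⟩
    ((1# + y ^ 9) * w) * ((1# - y) * z) * (1# - y) ^ 8
      ≈⟨ *-congʳ (*-cong p q) ⟩
    1# * 1# * (1# - y) ^ 8
      ≈⟨ trans (*-congʳ (*-identityˡ 1#)) (*-identityˡ _) ⟩
    (1# - y) ^ 8 ∎

  -- The hypothesis is θ(A B) computed by the product rule and from the square B(q²)². Since 2 a b =
  -- -a b, what remains is a b ((a + b)² - 1), factored here so that its unit factors can be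
  -- cancelled.
  sum-squared : ∀ a b → (a - a ^ 3) * b + a * (b - b ^ 3) ≈ a * b - a * b * (a * b) →
    a * b * ((a + b - 1#) * (a + b + 1#)) ≈ 0#
  sum-squared a b e = begin
    a * b * ((a + b - 1#) * (a + b + 1#))
      ≈⟨ solve 2 (λ a b → a :* b :* ((a :+ b :- :1) :* (a :+ b :+ :1))
           := con 2₃ :* ((a :- a :^ 3) :* b :+ a :* (b :- b :^ 3) :- (a :* b :- a :* b :* (a :* b)))) refl a b ⟩
    - 1# * ((a - a ^ 3) * b + a * (b - b ^ 3) - (a * b - a * b * (a * b)))
      ≈⟨ times-zero _ (difference-zero e) ⟩
    0# ∎

-- Power series modulo 3

infix 4 _≡₃_

record _≡₃_ (a b : ℤ) : Set where
  constructor mod₃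
  field
    3∣difference : + 3 ℤ∣.∣ a ℤ.- b

≡⇒≡₃ : ∀ {a b} → a ≡ b → a ≡₃ b
≡⇒≡₃ {a} ≡.refl = mod₃ (divides (+ 0) (ℤₚ.+-inverseʳ a))

≡₃-refl : ∀ {a} → a ≡₃ a
≡₃-refl = ≡⇒≡₃ ≡.refl

≡₃-sym : ∀ {a b} → a ≡₃ b → b ≡₃ a
≡₃-sym {a} {b} (mod₃ d) = mod₃ (≡.subst (+ 3 ℤ∣.∣_) (flip a b) (ℤ∣.∣m⇒∣-m d))
  where
  flip : ∀ a b → ℤ.- (a ℤ.- b) ≡ b ℤ.- a
  flip = ℤSolver.solve-∀

≡₃-trans : ∀ {a b c} → a ≡₃ b → b ≡₃ c → a ≡₃ c
≡₃-trans {a} {b} {c} (mod₃ d) (mod₃ e) = mod₃ (≡.subst (+ 3 ℤ∣.∣_) (telescope a b c) (ℤ∣.∣m∣n⇒∣m+n d e))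
  where
  telescope : ∀ a b c → (a ℤ.- b) ℤ.+ (b ℤ.- c) ≡ a ℤ.- c
  telescope = ℤSolver.solve-∀

+-cong₃ : ∀ {a b c d} → a ≡₃ b → c ≡₃ d → a ℤ.+ c ≡₃ b ℤ.+ d
+-cong₃ {a} {b} {c} {d} (mod₃ p) (mod₃ q) = mod₃ (≡.subst (+ 3 ℤ∣.∣_) (regroup a b c d) (ℤ∣.∣m∣n⇒∣m+n p q))
  where
  regroup : ∀ a b c d → (a ℤ.- b) ℤ.+ (c ℤ.- d) ≡ (a ℤ.+ c) ℤ.- (b ℤ.+ d)
  regroup = ℤSolver.solve-∀

*-cong₃ : ∀ {a b c d} → a ≡₃ b → c ≡₃ d → a ℤ.* c ≡₃ b ℤ.* d
*-cong₃ {a} {b} {c} {d} (mod₃ p) (mod₃ q) = mod₃ (≡.subst (+ 3 ℤ∣.∣_) (regroup a b c d)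
  (ℤ∣.∣m∣n⇒∣m+n (ℤ∣.∣n⇒∣m*n a q) (ℤ∣.∣n⇒∣m*n d p)))
  where
  regroup : ∀ a b c d → a ℤ.* (c ℤ.- d) ℤ.+ d ℤ.* (a ℤ.- b) ≡ a ℤ.* c ℤ.- b ℤ.* d
  regroup = ℤSolver.solve-∀

-‿cong₃ : ∀ {a b} → a ≡₃ b → ℤ.- a ≡₃ ℤ.- b
-‿cong₃ {a} {b} (mod₃ p) = mod₃ (≡.subst (+ 3 ℤ∣.∣_) (regroup a b) (ℤ∣.∣m⇒∣-m p))
  where
  regroup : ∀ a b → ℤ.- (a ℤ.- b) ≡ ℤ.- a ℤ.- ℤ.- b
  regroup = ℤSolver.solve-∀

infix 4 _≗_

_≗_ : Series → Series → Set
f ≗ g = ∀ n → f n ≡ g n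

infixl 6 _⊕_
infixr 8 _•_

_⊕_ : Series → Series → Series
(f ⊕ g) n = f n ℤ.+ g n

⊖_ : Series → Series
(⊖ f) n = ℤ.- f n

_•_ : ℤ → Series → Series
(c • f) n = c ℤ.* f n

𝟘 : Series
𝟘 _ = + 0

tail : Series → Series
tail f n = f (suc n)

-- `convSum` descends from the top index, whereas inductions on products need the decomposition f =
-- f(0) + q · `tail f`.
·-suc : ∀ f g n → (f · g) (suc n) ≡ f 0 ℤ.* g (suc n) ℤ.+ (tail f · g) n
·-suc f g n = convSum-suc n
  where
  rotate : ∀ a b c → a ℤ.+ (b ℤ.+ c) ≡ b ℤ.+ (a ℤ.+ c)
  rotate = ℤSolver.solve-∀
  convSum-suc : ∀ k → convSum f g (suc n) (suc k) ≡ f 0 ℤ.* g (suc n) ℤ.+ convSum (tail f) g n k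
  convSum-suc zero    = ℤₚ.+-comm _ (f 0 ℤ.* g (suc n))
  convSum-suc (suc k) = ≡.trans (cong (ℤ._+_ (f (suc (suc k)) ℤ.* g (n ∸ suc k))) (convSum-suc k))
    (rotate (f (suc (suc k)) ℤ.* g (n ∸ suc k)) (f 0 ℤ.* g (suc n)) (convSum (tail f) g n k))

-- The bounds i ≤ n make congruence modulo q^K compatible with products.
·-cong₃ : ∀ {f f′ g g′} n → (∀ i → i ≤ n → f i ≡₃ f′ i) → (∀ i → i ≤ n → g i ≡₃ g′ i) →
  (f · g) n ≡₃ (f′ · g′) n
·-cong₃ zero p q = *-cong₃ (p 0 z≤n) (q 0 z≤n)
·-cong₃ {f} {f′} {g} {g′} (suc n) p q = ≡₃-trans (≡⇒≡₃ (·-suc f g n)) (≡₃-trans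
  (+-cong₃ (*-cong₃ (p 0 z≤n) (q (suc n) ℕₚ.≤-refl))
           (·-cong₃ n (λ i i≤n → p (suc i) (s≤s i≤n)) (λ i i≤n → q i (ℕₚ.m≤n⇒m≤1+n i≤n))))
  (≡⇒≡₃ (≡.sym (·-suc f′ g′ n))))

·-congˡ : ∀ {f f′ g} → f ≗ f′ → f · g ≗ f′ · g
·-congˡ {g = g} p zero = cong (ℤ._* g 0) (p 0)
·-congˡ {f} {f′} {g} p (suc n) = ≡.trans (·-suc f g n) (≡.trans
  (cong₂ ℤ._+_ (cong (ℤ._* g (suc n)) (p 0)) (·-congˡ (λ i → p (suc i)) n)) (≡.sym (·-suc f′ g n)))

·-distribʳ : ∀ f g h → (f ⊕ g) · h ≗ (f · h) ⊕ (g · h)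
·-distribʳ f g h zero    = ℤₚ.*-distribʳ-+ (h 0) (f 0) (g 0)
·-distribʳ f g h (suc n) = begin
  ((f ⊕ g) · h) (suc n)
    ≡⟨ ·-suc (f ⊕ g) h n ⟩
  (f 0 ℤ.+ g 0) ℤ.* h (suc n) ℤ.+ ((tail f ⊕ tail g) · h) n
    ≡⟨ cong (ℤ._+_ ((f 0 ℤ.+ g 0) ℤ.* h (suc n))) (·-distribʳ (tail f) (tail g) h n) ⟩
  (f 0 ℤ.+ g 0) ℤ.* h (suc n) ℤ.+ ((tail f · h) n ℤ.+ (tail g · h) n)
    ≡⟨ regroup (f 0) (g 0) (h (suc n)) _ _ ⟩
  (f 0 ℤ.* h (suc n) ℤ.+ (tail f · h) n) ℤ.+ (g 0 ℤ.* h (suc n) ℤ.+ (tail g · h) n)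
    ≡⟨ cong₂ ℤ._+_ (·-suc f h n) (·-suc g h n) ⟨
  (f · h) (suc n) ℤ.+ (g · h) (suc n) ∎
  where
  open ≡.≡-Reasoning
  regroup : ∀ a b c d e → (a ℤ.+ b) ℤ.* c ℤ.+ (d ℤ.+ e) ≡ (a ℤ.* c ℤ.+ d) ℤ.+ (b ℤ.* c ℤ.+ e)
  regroup = ℤSolver.solve-∀

•-· : ∀ c f g → (c • f) · g ≗ c • (f · g)
•-· c f g zero    = ℤₚ.*-assoc c (f 0) (g 0)
•-· c f g (suc n) = begin
  ((c • f) · g) (suc n)
    ≡⟨ ·-suc (c • f) g n ⟩
  c ℤ.* f 0 ℤ.* g (suc n) ℤ.+ ((c • tail f) · g) n
    ≡⟨ cong (ℤ._+_ (c ℤ.* f 0 ℤ.* g (suc n))) (•-· c (tail f) g n) ⟩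
  c ℤ.* f 0 ℤ.* g (suc n) ℤ.+ c ℤ.* (tail f · g) n
    ≡⟨ regroup c (f 0) (g (suc n)) _ ⟩
  c ℤ.* (f 0 ℤ.* g (suc n) ℤ.+ (tail f · g) n)
    ≡⟨ cong (c ℤ.*_) (·-suc f g n) ⟨
  c ℤ.* (f · g) (suc n) ∎
  where
  open ≡.≡-Reasoning
  regroup : ∀ a b c d → a ℤ.* b ℤ.* c ℤ.+ a ℤ.* d ≡ a ℤ.* (b ℤ.* c ℤ.+ d)
  regroup = ℤSolver.solve-∀

⊖-· : ∀ f g → (⊖ f) · g ≗ ⊖ (f · g)
⊖-· f g n = ≡.trans (·-congˡ (λ i → ≡.sym (ℤₚ.-1*i≡-i (f i))) n)
  (≡.trans (•-· ℤ.-1ℤ f g n) (ℤₚ.-1*i≡-i ((f · g) n)))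

·-zeroˡ : ∀ f → 𝟘 · f ≗ 𝟘
·-zeroˡ f zero    = ≡.refl
·-zeroˡ f (suc n) = ≡.trans (·-suc 𝟘 f n) (≡.trans (ℤₚ.+-identityˡ _) (·-zeroˡ f n))

·-identityˡ : ∀ f → one · f ≗ f
·-identityˡ f zero    = ℤₚ.*-identityˡ (f 0)
·-identityˡ f (suc n) = ≡.trans (·-suc one f n)
  (≡.trans (cong₂ ℤ._+_ (ℤₚ.*-identityˡ (f (suc n))) (·-zeroˡ f n)) (ℤₚ.+-identityʳ _))

-- Peeling off the heads of both factors reduces index n + 2 to the indices n + 1 and n.
·-comm : ∀ f g → f · g ≗ g · f
·-comm f g zero = ℤₚ.*-comm (f 0) (g 0)
·-comm f g (suc zero) = begin
  (f · g) 1                           ≡⟨ ·-suc f g 0 ⟩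
  f 0 ℤ.* g 1 ℤ.+ f 1 ℤ.* g 0         ≡⟨ swap (f 0) (g 1) (f 1) (g 0) ⟩
  g 0 ℤ.* f 1 ℤ.+ g 1 ℤ.* f 0         ≡⟨ ·-suc g f 0 ⟨
  (g · f) 1                           ∎
  where
  open ≡.≡-Reasoning
  swap : ∀ a b c d → a ℤ.* b ℤ.+ c ℤ.* d ≡ d ℤ.* c ℤ.+ b ℤ.* a
  swap = ℤSolver.solve-∀
·-comm f g (suc (suc n)) = begin
  (f · g) (2 ℕ.+ n)
    ≡⟨ ·-suc f g (suc n) ⟩
  f 0 ℤ.* g (2 ℕ.+ n) ℤ.+ (tail f · g) (suc n)
    ≡⟨ cong (ℤ._+_ (f 0 ℤ.* g (2 ℕ.+ n))) (≡.trans (·-comm (tail f) g (suc n)) (·-suc g (tail f) n)) ⟩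
  f 0 ℤ.* g (2 ℕ.+ n) ℤ.+ (g 0 ℤ.* f (2 ℕ.+ n) ℤ.+ (tail g · tail f) n)
    ≡⟨ cong (λ z → f 0 ℤ.* g (2 ℕ.+ n) ℤ.+ (g 0 ℤ.* f (2 ℕ.+ n) ℤ.+ z)) (·-comm (tail g) (tail f) n) ⟩
  f 0 ℤ.* g (2 ℕ.+ n) ℤ.+ (g 0 ℤ.* f (2 ℕ.+ n) ℤ.+ (tail f · tail g) n)
    ≡⟨ rotate (f 0 ℤ.* g (2 ℕ.+ n)) (g 0 ℤ.* f (2 ℕ.+ n)) _ ⟩
  g 0 ℤ.* f (2 ℕ.+ n) ℤ.+ (f 0 ℤ.* g (2 ℕ.+ n) ℤ.+ (tail f · tail g) n)
    ≡⟨ cong (ℤ._+_ (g 0 ℤ.* f (2 ℕ.+ n))) (≡.trans (·-comm (tail g) f (suc n)) (·-suc f (tail g) n)) ⟨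
  g 0 ℤ.* f (2 ℕ.+ n) ℤ.+ (tail g · f) (suc n)
    ≡⟨ ·-suc g f (suc n) ⟨
  (g · f) (2 ℕ.+ n) ∎
  where
  open ≡.≡-Reasoning
  rotate : ∀ a b c → a ℤ.+ (b ℤ.+ c) ≡ b ℤ.+ (a ℤ.+ c)
  rotate = ℤSolver.solve-∀

·-assoc : ∀ f g h → (f · g) · h ≗ f · (g · h)
·-assoc f g h zero    = ℤₚ.*-assoc (f 0) (g 0) (h 0)
·-assoc f g h (suc n) = begin
  ((f · g) · h) (suc n)
    ≡⟨ ·-suc (f · g) h n ⟩
  f 0 ℤ.* g 0 ℤ.* h (suc n) ℤ.+ (tail (f · g) · h) n
    ≡⟨ cong (ℤ._+_ (f 0 ℤ.* g 0 ℤ.* h (suc n))) 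
         (≡.trans (·-congˡ (·-suc f g) n) (·-distribʳ (f 0 • tail g) (tail f · g) h n)) ⟩
  f 0 ℤ.* g 0 ℤ.* h (suc n) ℤ.+ (((f 0 • tail g) · h) n ℤ.+ ((tail f · g) · h) n)
    ≡⟨ cong (ℤ._+_ (f 0 ℤ.* g 0 ℤ.* h (suc n))) (cong₂ ℤ._+_ (•-· (f 0) (tail g) h n) (·-assoc (tail f) g h n)) ⟩
  f 0 ℤ.* g 0 ℤ.* h (suc n) ℤ.+ (f 0 ℤ.* (tail g · h) n ℤ.+ (tail f · (g · h)) n)
    ≡⟨ regroup (f 0) (g 0) (h (suc n)) _ _ ⟩
  f 0 ℤ.* (g 0 ℤ.* h (suc n) ℤ.+ (tail g · h) n) ℤ.+ (tail f · (g · h)) n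
    ≡⟨ cong (λ z → f 0 ℤ.* z ℤ.+ (tail f · (g · h)) n) (·-suc g h n) ⟨
  f 0 ℤ.* (g · h) (suc n) ℤ.+ (tail f · (g · h)) n
    ≡⟨ ·-suc f (g · h) n ⟨
  (f · (g · h)) (suc n) ∎
  where
  open ≡.≡-Reasoning
  regroup : ∀ a b c d e → a ℤ.* b ℤ.* c ℤ.+ (a ℤ.* d ℤ.+ e) ≡ a ℤ.* (b ℤ.* c ℤ.+ d) ℤ.+ e
  regroup = ℤSolver.solve-∀

-- Integer power series modulo 3 and modulo q^K.
seriesRing : ℕ → CommutativeRing _ _
seriesRing K = record
  { Carrier = Series ; _≈_ = _≈_ ; _+_ = _⊕_ ; _*_ = _·_ ; -_ = ⊖_ ; 0# = 𝟘 ; 1# = one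
  ; isCommutativeRing = record
    { isRing = record
      { +-isAbelianGroup = record
        { isGroup = record
          { isMonoid = record
            { isSemigroup = record
              { isMagma = record
                { isEquivalence = record
                  { refl  = λ _ _ → ≡₃-refl
                  ; sym   = λ p n n<K → ≡₃-sym (p n n<K)
                  ; trans = λ p q n n<K → ≡₃-trans (p n n<K) (q n n<K)
                  }
                ; ∙-cong = λ p q n n<K → +-cong₃ (p n n<K) (q n n<K)
                }
              ; assoc = λ f g h → exact (λ n → ℤₚ.+-assoc (f n) (g n) (h n))
              }
            ; identity = (λ f → exact (λ n → ℤₚ.+-identityˡ (f n)))
                       , (λ f → exact (λ n → ℤₚ.+-identityʳ (f n)))
            }
          ; inverse = (λ f → exact (λ n → ℤₚ.+-inverseˡ (f n)))
                    , (λ f → exact (λ n → ℤₚ.+-inverseʳ (f n)))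
          ; ⁻¹-cong = λ p n n<K → -‿cong₃ (p n n<K)
          }
        ; comm = λ f g → exact (λ n → ℤₚ.+-comm (f n) (g n))
        }
      ; *-cong = λ p q n n<K → ·-cong₃ n
          (λ i i≤n → p i (ℕₚ.≤-<-trans i≤n n<K)) (λ i i≤n → q i (ℕₚ.≤-<-trans i≤n n<K))
      ; *-assoc = λ f g h → exact (·-assoc f g h)
      ; *-identity = (λ f → exact (·-identityˡ f))
                   , (λ f → exact (λ n → ≡.trans (·-comm f one n) (·-identityˡ f n)))
      ; distrib = (λ f g h → exact (distribˡ f g h)) , (λ h f g → exact (·-distribʳ f g h))
      }
    ; *-comm = λ f g → exact (·-comm f g)
    }
  }
  where
  infix 4 _≈_
  _≈_ : Series → Series → Set
  f ≈ g = ∀ n → n < K → f n ≡₃ g n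
  exact : ∀ {f g} → f ≗ g → f ≈ g
  exact p n _ = ≡⇒≡₃ (p n)
  distribˡ : ∀ f g h → f · (g ⊕ h) ≗ (f · g) ⊕ (f · h)
  distribˡ f g h n = ≡.trans (·-comm f (g ⊕ h) n)
    (≡.trans (·-distribʳ g h f n) (cong₂ ℤ._+_ (·-comm g f n) (·-comm h f n)))

seriesRing-char3 : ∀ K → CommutativeRing._≈_ (seriesRing K) (one ⊕ one ⊕ one) 𝟘
seriesRing-char3 K zero    _ = mod₃ (divides (+ 1) ≡.refl)
seriesRing-char3 K (suc n) _ = ≡₃-refl

module Mod₃ (K : ℕ) where
  open CommutativeRing (seriesRing K) public
    using (_≈_; setoid; refl; sym; trans; +-cong; +-congˡ; *-cong; *-congˡ; *-congʳ; -‿cong)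
  open Char3 (seriesRing K) (seriesRing-char3 K) public

-- Monomials and the inverses of 1 - q^m and 1 + q^m

q : Series
q zero    = + 0
q (suc n) = one n

q·-suc : ∀ f n → (q · f) (suc n) ≡ f n
q·-suc f n = ≡.trans (·-suc q f n) (≡.trans (ℤₚ.+-identityˡ _) (·-identityˡ f n))

monomial : ℕ → Series
monomial zero    n       = one n
monomial (suc k) zero    = + 0
monomial (suc k) (suc n) = monomial k n

shift : ℕ → Series → Series
shift zero    f n       = f n
shift (suc k) f zero    = + 0
shift (suc k) f (suc n) = shift k f n

monomial-· : ∀ k f → monomial k · f ≗ shift k f
monomial-· zero    f n       = ·-identityˡ f n
monomial-· (suc k) f zero    = ≡.refl
monomial-· (suc k) f (suc n) =
  ≡.trans (·-suc (monomial (suc k)) f n) (≡.trans (ℤₚ.+-identityˡ _) (monomial-· k f n))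

shift-< : ∀ {k n} f → n < k → shift k f n ≡ + 0
shift-< {suc k} {zero}  f _         = ≡.refl
shift-< {suc k} {suc n} f (s≤s n<k) = shift-< f n<k

shift-≥ : ∀ {k n} f → k ≤ n → shift k f n ≡ f (n ∸ k)
shift-≥ {zero}          f _         = ≡.refl
shift-≥ {suc k} {suc n} f (s≤s k≤n) = shift-≥ f k≤n

monomial-≢ : ∀ {k n} → k ≡.≢ n → monomial k n ≡ + 0
monomial-≢ {zero}  {zero}  k≢n = ⊥-elim (k≢n ≡.refl)
monomial-≢ {zero}  {suc n} k≢n = ≡.refl
monomial-≢ {suc k} {zero}  k≢n = ≡.refl
monomial-≢ {suc k} {suc n} k≢n = monomial-≢ (λ k≡n → k≢n (cong suc k≡n))

monomial-≡ : ∀ n → monomial n n ≡ + 1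
monomial-≡ zero    = ≡.refl
monomial-≡ (suc n) = monomial-≡ n

onePlus-monomial : ∀ k → onePlus (suc k) ≗ one ⊕ monomial (suc k)
onePlus-monomial k zero    = ≡.refl
onePlus-monomial k (suc n) = peak k n
  where
  peak : ∀ k n → (if n ≡ᵇ k then + 1 else + 0) ≡ + 0 ℤ.+ monomial k n
  peak zero    zero    = ≡.refl
  peak zero    (suc n) = ≡.refl
  peak (suc k) zero    = ≡.refl
  peak (suc k) (suc n) = peak k n

oneMinus-monomial : ∀ k → oneMinus (suc k) ≗ one ⊕ (⊖ monomial (suc k))
oneMinus-monomial k zero    = ≡.refl
oneMinus-monomial k (suc n) = peak k n
  where
  peak : ∀ k n → (if n ≡ᵇ k then -[1+ 0 ] else + 0) ≡ + 0 ℤ.+ ℤ.- monomial k n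
  peak zero    zero    = ≡.refl
  peak zero    (suc n) = ≡.refl
  peak (suc k) zero    = ≡.refl
  peak (suc k) (suc n) = peak k n

invOneMinus-inverse : ∀ k → (one ⊕ (⊖ monomial (suc k))) · invOneMinus (suc k) ≗ one
invOneMinus-inverse k n = ≡.trans (·-distribʳ one (⊖ monomial m) f n)
  (≡.trans (cong₂ ℤ._+_ (·-identityˡ f n) (≡.trans (⊖-· (monomial m) f n) (cong ℤ.-_ (monomial-· m f n)))) difference)
  where
  m = suc k
  f = invOneMinus m
  below : ∀ n → n < m → f n ℤ.- + 0 ≡ one n
  below zero    _   = ≡.refl
  below (suc n) n<m rewrite DivMod.m<n⇒m%n≡m n<m = ≡.refl
  difference : f n ℤ.- shift m f n ≡ one n
  difference with m ℕₚ.≤? n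
  ... | yes m≤n@(s≤s _) rewrite shift-≥ f m≤n | DivMod.m≤n⇒[n∸m]%m≡n%m m≤n = ℤₚ.+-inverseʳ (f n)
  ... | no  m≰n rewrite shift-< f (ℕₚ.≰⇒> m≰n) = below n (ℕₚ.≰⇒> m≰n)

invOnePlus-inverse : ∀ k → (one ⊕ monomial (suc k)) · invOnePlus (suc k) ≗ one
invOnePlus-inverse k n = ≡.trans (·-distribʳ one (monomial m) f n)
  (≡.trans (cong₂ ℤ._+_ (·-identityˡ f n) (monomial-· m f n)) total)
  where
  m = suc k
  f = invOnePlus m
  below : ∀ n → n < m → f n ℤ.+ + 0 ≡ one n
  below zero    _   = ≡.refl
  below (suc n) n<m rewrite DivMod.m<n⇒m%n≡m n<m = ≡.refl
  total : f n ℤ.+ shift m f n ≡ one n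
  total with m ℕₚ.≤? n
  ... | no  m≰n rewrite shift-< f (ℕₚ.≰⇒> m≰n) = below n (ℕₚ.≰⇒> m≰n)
  ... | yes m≤n@(s≤s _) rewrite shift-≥ f m≤n | DivMod.m≤n⇒[n∸m]%m≡n%m m≤n | DivMod.m/n≡1+[m∸n]/n m≤n
        with n % m ≡ᵇ 0
  ...     | true  = ℤₚ.+-inverseˡ (sign ((n ∸ m) ℕ./ m))
  ...     | false = ≡.refl

-- The derivation θ, the sign change q ↦ -q, dilations and sections

θ : Series → Series
θ f n = + n ℤ.* f n

alternate : Series → Series
alternate f n = sign n ℤ.* f n

dilate₂ : Series → Series
dilate₂ f 0             = f 0
dilate₂ f 1             = + 0
dilate₂ f (suc (suc n)) = dilate₂ (tail f) n

dilate₃ : Series → Series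
dilate₃ f 0                   = f 0
dilate₃ f 1                   = + 0
dilate₃ f 2                   = + 0
dilate₃ f (suc (suc (suc n))) = dilate₃ (tail f) n

section₃ : Series → Series
section₃ f n = f (n ℕ.* 3)

private
  θ-tail : ∀ f → tail (θ f) ≗ θ (tail f) ⊕ tail f
  θ-tail f n = ≡.trans (ℤₚ.*-distribʳ-+ (f (suc n)) (+ 1) (+ n)) (lemma (+ n ℤ.* f (suc n)) (f (suc n)))
    where
    lemma : ∀ a b → + 1 ℤ.* b ℤ.+ a ≡ a ℤ.+ b
    lemma = ℤSolver.solve-∀

θ-· : ∀ f g → θ (f · g) ≗ (θ f · g) ⊕ (f · θ g)
θ-· f g zero    = base (f 0) (g 0)
  where
  base : ∀ a b → + 0 ℤ.* (a ℤ.* b) ≡ + 0 ℤ.* a ℤ.* b ℤ.+ a ℤ.* (+ 0 ℤ.* b)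
  base = ℤSolver.solve-∀
θ-· f g (suc n) = begin
  θ (f · g) (suc n)
    ≡⟨ cong (+ suc n ℤ.*_) (·-suc f g n) ⟩
  + suc n ℤ.* (f 0 ℤ.* g (suc n) ℤ.+ (tail f · g) n)
    ≡⟨ expand (+ n) (f 0) (g (suc n)) ((tail f · g) n) ⟩
  f 0 ℤ.* (+ suc n ℤ.* g (suc n)) ℤ.+ (tail f · g) n ℤ.+ θ (tail f · g) n
    ≡⟨ cong (ℤ._+_ (f 0 ℤ.* (+ suc n ℤ.* g (suc n)) ℤ.+ (tail f · g) n)) (θ-· (tail f) g n) ⟩
  f 0 ℤ.* (+ suc n ℤ.* g (suc n)) ℤ.+ (tail f · g) n ℤ.+ ((θ (tail f) · g) n ℤ.+ (tail f · θ g) n)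
    ≡⟨ regroup (f 0) (g (suc n)) (f 0 ℤ.* (+ suc n ℤ.* g (suc n))) ((tail f · g) n) ((θ (tail f) · g) n) ((tail f · θ g) n) ⟩
  (θ f 0 ℤ.* g (suc n) ℤ.+ ((θ (tail f) · g) n ℤ.+ (tail f · g) n))
  ℤ.+ (f 0 ℤ.* (+ suc n ℤ.* g (suc n)) ℤ.+ (tail f · θ g) n)
    ≡⟨ cong (λ z → (θ f 0 ℤ.* g (suc n) ℤ.+ z) ℤ.+ (f 0 ℤ.* (+ suc n ℤ.* g (suc n)) ℤ.+ (tail f · θ g) n))
         (≡.trans (·-congˡ (θ-tail f) n) (·-distribʳ (θ (tail f)) (tail f) g n)) ⟨
  (θ f 0 ℤ.* g (suc n) ℤ.+ (tail (θ f) · g) n)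
  ℤ.+ (f 0 ℤ.* (+ suc n ℤ.* g (suc n)) ℤ.+ (tail f · θ g) n)
    ≡⟨ cong₂ ℤ._+_ (·-suc (θ f) g n) (·-suc f (θ g) n) ⟨
  (θ f · g) (suc n) ℤ.+ (f · θ g) (suc n) ∎
  where
  open ≡.≡-Reasoning
  expand : ∀ n a b c → (+ 1 ℤ.+ n) ℤ.* (a ℤ.* b ℤ.+ c) ≡ a ℤ.* ((+ 1 ℤ.+ n) ℤ.* b) ℤ.+ c ℤ.+ n ℤ.* c
  expand = ℤSolver.solve-∀
  regroup : ∀ a b c d e h →
    c ℤ.+ d ℤ.+ (e ℤ.+ h) ≡ (+ 0 ℤ.* a ℤ.* b ℤ.+ (e ℤ.+ d)) ℤ.+ (c ℤ.+ h)
  regroup = ℤSolver.solve-∀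

θ-alternate : ∀ f → θ (alternate f) ≗ alternate (θ f)
θ-alternate f n = exchange (+ n) (sign n) (f n)
  where
  exchange : ∀ a b c → a ℤ.* (b ℤ.* c) ≡ b ℤ.* (a ℤ.* c)
  exchange = ℤSolver.solve-∀

dilate₂-ext : ∀ {f g} → f ≗ g → dilate₂ f ≗ dilate₂ g
dilate₂-ext p 0             = p 0
dilate₂-ext p 1             = ≡.refl
dilate₂-ext p (suc (suc n)) = dilate₂-ext (λ i → p (suc i)) n

dilate₂-cong₃ : ∀ {f g} n → (∀ i → i ℕ.+ i ≤ n → f i ≡₃ g i) → dilate₂ f n ≡₃ dilate₂ g n
dilate₂-cong₃ 0             p = p 0 z≤n
dilate₂-cong₃ 1             p = ≡₃-refl
dilate₂-cong₃ (suc (suc n)) p = dilate₂-cong₃ n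
  (λ i i+i≤n → p (suc i) (s≤s (≡.subst (_≤ suc n) (≡.sym (ℕₚ.+-suc i i)) (s≤s i+i≤n))))

dilate₂-⊕ : ∀ f g → dilate₂ (f ⊕ g) ≗ dilate₂ f ⊕ dilate₂ g
dilate₂-⊕ f g 0             = ≡.refl
dilate₂-⊕ f g 1             = ≡.refl
dilate₂-⊕ f g (suc (suc n)) = dilate₂-⊕ (tail f) (tail g) n

dilate₂-• : ∀ c f → dilate₂ (c • f) ≗ c • dilate₂ f
dilate₂-• c f 0             = ≡.refl
dilate₂-• c f 1             = ≡.sym (ℤₚ.*-zeroʳ c)
dilate₂-• c f (suc (suc n)) = dilate₂-• c (tail f) n

dilate₂-⊖ : ∀ f → dilate₂ (⊖ f) ≗ ⊖ dilate₂ f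
dilate₂-⊖ f 0             = ≡.refl
dilate₂-⊖ f 1             = ≡.refl
dilate₂-⊖ f (suc (suc n)) = dilate₂-⊖ (tail f) n

dilate₂-𝟘 : dilate₂ 𝟘 ≗ 𝟘
dilate₂-𝟘 0             = ≡.refl
dilate₂-𝟘 1             = ≡.refl
dilate₂-𝟘 (suc (suc n)) = dilate₂-𝟘 n

dilate₂-one : dilate₂ one ≗ one
dilate₂-one 0             = ≡.refl
dilate₂-one 1             = ≡.refl
dilate₂-one (suc (suc n)) = dilate₂-𝟘 n

private
  dilate₂-tail : ∀ f g n →
    (dilate₂ f · g) (suc (suc n)) ≡ f 0 ℤ.* g (suc (suc n)) ℤ.+ (dilate₂ (tail f) · g) n
  dilate₂-tail f g n = ≡.trans (·-suc (dilate₂ f) g (suc n)) (cong (ℤ._+_ (f 0 ℤ.* g (suc (suc n))))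
    (≡.trans (·-suc (tail (dilate₂ f)) g n) (ℤₚ.+-identityˡ _)))

  dilate₃-tail : ∀ f g n →
    (dilate₃ f · g) (suc (suc (suc n))) ≡ f 0 ℤ.* g (suc (suc (suc n))) ℤ.+ (dilate₃ (tail f) · g) n
  dilate₃-tail f g n = ≡.trans (·-suc (dilate₃ f) g (suc (suc n))) (cong (ℤ._+_ (f 0 ℤ.* g (suc (suc (suc n)))))
    (≡.trans (·-suc (tail (dilate₃ f)) g (suc n)) (≡.trans (ℤₚ.+-identityˡ _)
    (≡.trans (·-suc (tail (tail (dilate₃ f))) g n) (ℤₚ.+-identityˡ _)))))

dilate₂-· : ∀ f g → dilate₂ (f · g) ≗ dilate₂ f · dilate₂ g
dilate₂-· f g 0 = ≡.refl
dilate₂-· f g 1 = ≡.sym (≡.trans (·-suc (dilate₂ f) (dilate₂ g) 0) (zeros (f 0) (g 0)))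
  where
  zeros : ∀ a b → a ℤ.* + 0 ℤ.+ + 0 ℤ.* b ≡ + 0
  zeros = ℤSolver.solve-∀
dilate₂-· f g (suc (suc n)) = begin
  dilate₂ (tail (f · g)) n
    ≡⟨ dilate₂-ext (·-suc f g) n ⟩
  dilate₂ ((f 0 • tail g) ⊕ (tail f · g)) n
    ≡⟨ dilate₂-⊕ (f 0 • tail g) (tail f · g) n ⟩
  dilate₂ (f 0 • tail g) n ℤ.+ dilate₂ (tail f · g) n
    ≡⟨ cong₂ ℤ._+_ (dilate₂-• (f 0) (tail g) n) (dilate₂-· (tail f) g n) ⟩
  f 0 ℤ.* dilate₂ (tail g) n ℤ.+ (dilate₂ (tail f) · dilate₂ g) n
    ≡⟨ dilate₂-tail f (dilate₂ g) n ⟨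
  (dilate₂ f · dilate₂ g) (suc (suc n)) ∎
  where open ≡.≡-Reasoning

θ-dilate₂ : ∀ f → θ (dilate₂ f) ≗ (+ 2) • dilate₂ (θ f)
θ-dilate₂ f 0             = zeros (f 0)
  where
  zeros : ∀ a → + 0 ℤ.* a ≡ + 2 ℤ.* (+ 0 ℤ.* a)
  zeros = ℤSolver.solve-∀
θ-dilate₂ f 1             = ≡.refl
θ-dilate₂ f (suc (suc n)) = begin
  + suc (suc n) ℤ.* dilate₂ (tail f) n
    ≡⟨ expand (+ n) (dilate₂ (tail f) n) ⟩
  θ (dilate₂ (tail f)) n ℤ.+ + 2 ℤ.* dilate₂ (tail f) n
    ≡⟨ cong (ℤ._+ + 2 ℤ.* dilate₂ (tail f) n) (θ-dilate₂ (tail f) n) ⟩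
  + 2 ℤ.* dilate₂ (θ (tail f)) n ℤ.+ + 2 ℤ.* dilate₂ (tail f) n
    ≡⟨ ℤₚ.*-distribˡ-+ (+ 2) (dilate₂ (θ (tail f)) n) (dilate₂ (tail f) n) ⟨
  + 2 ℤ.* (dilate₂ (θ (tail f)) n ℤ.+ dilate₂ (tail f) n)
    ≡⟨ cong (+ 2 ℤ.*_) (≡.trans (dilate₂-ext (θ-tail f) n) (dilate₂-⊕ (θ (tail f)) (tail f) n)) ⟨
  + 2 ℤ.* dilate₂ (tail (θ f)) n ∎
  where
  open ≡.≡-Reasoning
  expand : ∀ n a → (+ 1 ℤ.+ (+ 1 ℤ.+ n)) ℤ.* a ≡ n ℤ.* a ℤ.+ + 2 ℤ.* a
  expand = ℤSolver.solve-∀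

dilate₃-ext : ∀ {f g} → f ≗ g → dilate₃ f ≗ dilate₃ g
dilate₃-ext p 0                   = p 0
dilate₃-ext p 1                   = ≡.refl
dilate₃-ext p 2                   = ≡.refl
dilate₃-ext p (suc (suc (suc n))) = dilate₃-ext (λ i → p (suc i)) n

dilate₃-⊖ : ∀ f → dilate₃ (⊖ f) ≗ ⊖ dilate₃ f
dilate₃-⊖ f 0                   = ≡.refl
dilate₃-⊖ f 1                   = ≡.refl
dilate₃-⊖ f 2                   = ≡.refl
dilate₃-⊖ f (suc (suc (suc n))) = dilate₃-⊖ (tail f) n

-- 3 n and n have the same parity.
dilate₃-alternate : ∀ f → dilate₃ (alternate f) ≗ alternate (dilate₃ f)
dilate₃-alternate f 0                   = ≡.refl
dilate₃-alternate f 1                   = ≡.refl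
dilate₃-alternate f 2                   = ≡.refl
dilate₃-alternate f (suc (suc (suc n))) = begin
  dilate₃ (tail (alternate f)) n
    ≡⟨ dilate₃-ext (λ i → ≡.sym (ℤₚ.neg-distribˡ-* (sign i) (f (suc i)))) n ⟩
  dilate₃ (⊖ alternate (tail f)) n
    ≡⟨ dilate₃-⊖ (alternate (tail f)) n ⟩
  ℤ.- dilate₃ (alternate (tail f)) n
    ≡⟨ cong ℤ.-_ (dilate₃-alternate (tail f) n) ⟩
  ℤ.- (sign n ℤ.* dilate₃ (tail f) n)
    ≡⟨ thrice (sign n) (dilate₃ (tail f) n) ⟩
  ℤ.- ℤ.- ℤ.- sign n ℤ.* dilate₃ (tail f) n ∎
  where
  open ≡.≡-Reasoning
  thrice : ∀ a b → ℤ.- (a ℤ.* b) ≡ ℤ.- ℤ.- ℤ.- a ℤ.* b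
  thrice = ℤSolver.solve-∀

-- A factor in q³ shifts exponents by multiples of 3 only, so it passes through U.
section₃-dilate₃-· : ∀ f g → section₃ (dilate₃ f · g) ≗ f · section₃ g
section₃-dilate₃-· f g zero    = ≡.refl
section₃-dilate₃-· f g (suc n) = begin
  (dilate₃ f · g) (suc (suc (suc (n ℕ.* 3))))
    ≡⟨ dilate₃-tail f g (n ℕ.* 3) ⟩
  f 0 ℤ.* section₃ g (suc n) ℤ.+ (dilate₃ (tail f) · g) (n ℕ.* 3)
    ≡⟨ cong (ℤ._+_ (f 0 ℤ.* section₃ g (suc n))) (section₃-dilate₃-· (tail f) g n) ⟩
  f 0 ℤ.* section₃ g (suc n) ℤ.+ (tail f · section₃ g) n
    ≡⟨ ·-suc f (section₃ g) n ⟨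
  (f · section₃ g) (suc n) ∎
  where open ≡.≡-Reasoning

section₃-dilate₃ : ∀ f → section₃ (dilate₃ f) ≗ f
section₃-dilate₃ f zero    = ≡.refl
section₃-dilate₃ f (suc n) = section₃-dilate₃ (tail f) n

-- The two operators commute because 2 and 3 are coprime: 3 n is even exactly when n is.
section₃-dilate₂ : ∀ f → section₃ (dilate₂ f) ≗ dilate₂ (section₃ f)
section₃-dilate₂ f 0             = ≡.refl
section₃-dilate₂ f 1             = ≡.refl
section₃-dilate₂ f (suc (suc n)) = section₃-dilate₂ (tail (tail (tail f))) n

-- The theta series and squares modulo 3

isSquare? : ∀ n → Dec (∃ λ j → j < suc n × j ℕ.* j ≡ n)
isSquare? n = ℕₚ.anyUpTo? (λ j → j ℕ.* j ℕₚ.≟ n) (suc n)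

-- The coefficients of 1 + 2 Σ q^{j²}, with 2 replaced by -1.
φ : Series
φ zero    = + 1
φ (suc n) = if does (isSquare? (suc n)) then -[1+ 0 ] else + 0

φ-square : ∀ j → φ (suc j ℕ.* suc j) ≡ -[1+ 0 ]
φ-square j with isSquare? (suc j ℕ.* suc j)
... | yes _ = ≡.refl
... | no ¬p = ⊥-elim (¬p (suc j , s≤s (ℕₚ.m≤m*n (suc j) (suc j)) , ≡.refl))

φ-nonsquare : ∀ n → (∀ j → j ℕ.* j ≢ n) → φ n ≡ + 0
φ-nonsquare zero    p = ⊥-elim (p 0 ≡.refl)
φ-nonsquare (suc n) p with isSquare? (suc n)
... | yes (j , _ , e) = ⊥-elim (p j e)
... | no _ = ≡.refl

data Residue₃ : ℕ → Set where
  0+ : ∀ m → Residue₃ (m ℕ.* 3)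
  1+ : ∀ m → Residue₃ (1 ℕ.+ m ℕ.* 3)
  2+ : ∀ m → Residue₃ (2 ℕ.+ m ℕ.* 3)

residue₃ : ∀ n → Residue₃ n
residue₃ 0 = 0+ 0
residue₃ 1 = 1+ 0
residue₃ 2 = 2+ 0
residue₃ (suc (suc (suc n))) with residue₃ n
... | 0+ m = 0+ (suc m)
... | 1+ m = 1+ (suc m)
... | 2+ m = 2+ (suc m)

dilate₃-1+ : ∀ f m → dilate₃ f (1 ℕ.+ m ℕ.* 3) ≡ + 0
dilate₃-1+ f zero    = ≡.refl
dilate₃-1+ f (suc m) = dilate₃-1+ (tail f) m

dilate₃-2+ : ∀ f m → dilate₃ f (2 ℕ.+ m ℕ.* 3) ≡ + 0
dilate₃-2+ f zero    = ≡.refl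
dilate₃-2+ f (suc m) = dilate₃-2+ (tail f) m

square-multiple₃ : ∀ k n → k ℕ.* k ≡ n ℕ.* 3 → ∃ λ j → k ≡ j ℕ.* 3 × n ≡ j ℕ.* j ℕ.* 3
square-multiple₃ k n e with reduce (euclidsLemma k k (toWitness {a? = prime? 3} tt) (ℕ∣.divides n e))
... | ℕ∣.divides j ≡.refl = j , ≡.refl , ℕₚ.*-cancelʳ-≡ n (j ℕ.* j ℕ.* 3) 3 (≡.trans (≡.sym e) (regroup j))
  where
  regroup : ∀ j → j ℕ.* 3 ℕ.* (j ℕ.* 3) ≡ j ℕ.* j ℕ.* 3 ℕ.* 3
  regroup = solve-∀

private
  remainder₃ : ∀ {n} r m → n ≡ r ℕ.+ m ℕ.* 3 → n % 3 ≡ r % 3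
  remainder₃ r m e = ≡.trans (cong (_% 3) e) (DivMod.[m+kn]%n≡m%n r m 3)

square≢2+ : ∀ k m → k ℕ.* k ≢ 2 ℕ.+ m ℕ.* 3
square≢2+ k m e with residue₃ k
... | 0+ j = contradiction (≡.trans (≡.sym (remainder₃ 2 m e)) (remainder₃ 0 (j ℕ.* j ℕ.* 3) (expand j))) λ ()
  where
  expand : ∀ j → j ℕ.* 3 ℕ.* (j ℕ.* 3) ≡ 0 ℕ.+ j ℕ.* j ℕ.* 3 ℕ.* 3
  expand = solve-∀
... | 1+ j = contradiction
    (≡.trans (≡.sym (remainder₃ 2 m e)) (remainder₃ 1 (j ℕ.* 2 ℕ.+ j ℕ.* j ℕ.* 3) (expand j))) λ ()
  where
  expand : ∀ j → (1 ℕ.+ j ℕ.* 3) ℕ.* (1 ℕ.+ j ℕ.* 3) ≡ 1 ℕ.+ (j ℕ.* 2 ℕ.+ j ℕ.* j ℕ.* 3) ℕ.* 3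
  expand = solve-∀
... | 2+ j = contradiction
    (≡.trans (≡.sym (remainder₃ 2 m e)) (remainder₃ 1 (1 ℕ.+ j ℕ.* 4 ℕ.+ j ℕ.* j ℕ.* 3) (expand j))) λ ()
  where
  expand : ∀ j → (2 ℕ.+ j ℕ.* 3) ℕ.* (2 ℕ.+ j ℕ.* 3) ≡ 1 ℕ.+ (1 ℕ.+ j ℕ.* 4 ℕ.+ j ℕ.* j ℕ.* 3) ℕ.* 3
  expand = solve-∀

φ-9* : ∀ m → φ (m ℕ.* 3 ℕ.* 3) ≡ φ m
φ-9* zero = ≡.refl
φ-9* m@(suc _) with isSquare? m
... | yes (suc j , _ , ≡.refl) =
      ≡.trans (cong φ (regroup j)) (φ-square (2 ℕ.+ j ℕ.* 3))
  where
  regroup : ∀ j → suc j ℕ.* suc j ℕ.* 3 ℕ.* 3 ≡ (3 ℕ.+ j ℕ.* 3) ℕ.* (3 ℕ.+ j ℕ.* 3)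
  regroup = solve-∀
... | no ¬p = φ-nonsquare (m ℕ.* 3 ℕ.* 3) λ k e → case (square-multiple₃ k (m ℕ.* 3) e)
  where
  case : ∀ {k} → (∃ λ j → k ≡ j ℕ.* 3 × m ℕ.* 3 ≡ j ℕ.* j ℕ.* 3) → ⊥
  case (zero  , _ , ())
  case (suc j , _ , e) = ¬p (suc j , s≤s (≡.subst (suc j ≤_) j²≡m (ℕₚ.m≤m*n (suc j) (suc j))) , j²≡m)
    where j²≡m = ≡.sym (ℕₚ.*-cancelʳ-≡ m (suc j ℕ.* suc j) 3 e)

-- A square divisible by 3 is divisible by 9, so 3 n is a square exactly when n is three times a
-- square.
section₃-φ : section₃ φ ≗ dilate₃ φ
section₃-φ n with residue₃ n
... | 0+ m = ≡.trans (φ-9* m) (≡.sym (section₃-dilate₃ φ m))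
... | 1+ m = ≡.trans (φ-nonsquare _ nonsquare) (≡.sym (dilate₃-1+ φ m))
  where
  nonsquare : ∀ k → k ℕ.* k ≢ (1 ℕ.+ m ℕ.* 3) ℕ.* 3
  nonsquare k e with square-multiple₃ k (1 ℕ.+ m ℕ.* 3) e
  ... | j , _ , e′ = contradiction (≡.trans (≡.sym (remainder₃ 1 m ≡.refl)) (remainder₃ 0 (j ℕ.* j) e′)) λ ()
... | 2+ m = ≡.trans (φ-nonsquare _ nonsquare) (≡.sym (dilate₃-2+ φ m))
  where
  nonsquare : ∀ k → k ℕ.* k ≢ (2 ℕ.+ m ℕ.* 3) ℕ.* 3
  nonsquare k e with square-multiple₃ k (2 ℕ.+ m ℕ.* 3) e
  ... | j , _ , e′ = contradiction (≡.trans (≡.sym (remainder₃ 2 m ≡.refl)) (remainder₃ 0 (j ℕ.* j) e′)) λ ()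

-- Squares are 0 or 1 modulo 3, so θ removes exactly the exponents divisible by 9.
θ-φ : ∀ n → θ φ n ≡₃ φ n ℤ.- dilate₃ (dilate₃ φ) n
θ-φ n with residue₃ n
... | 0+ m = mod₃ (divides (+ m ℤ.* φ (m ℕ.* 3)) (≡.trans
        (cong₂ (λ a b → a ℤ.* φ (m ℕ.* 3) ℤ.- (φ (m ℕ.* 3) ℤ.- b)) (ℤₚ.pos-* m 3)
               (≡.trans (section₃-dilate₃ (dilate₃ φ) m) (≡.sym (section₃-φ m))))
        (lemma (+ m) (φ (m ℕ.* 3)))))
  where
  lemma : ∀ a b → a ℤ.* + 3 ℤ.* b ℤ.- (b ℤ.- b) ≡ a ℤ.* b ℤ.* + 3
  lemma = ℤSolver.solve-∀
... | 1+ m = mod₃ (divides (+ m ℤ.* φ (1 ℕ.+ m ℕ.* 3)) (≡.trans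
        (cong₂ (λ a b → (+ 1 ℤ.+ a) ℤ.* φ (1 ℕ.+ m ℕ.* 3) ℤ.- (φ (1 ℕ.+ m ℕ.* 3) ℤ.- b)) (ℤₚ.pos-* m 3)
               (dilate₃-1+ (dilate₃ φ) m))
        (lemma (+ m) (φ (1 ℕ.+ m ℕ.* 3)))))
  where
  lemma : ∀ a b → (+ 1 ℤ.+ a ℤ.* + 3) ℤ.* b ℤ.- (b ℤ.- + 0) ≡ a ℤ.* b ℤ.* + 3
  lemma = ℤSolver.solve-∀
... | 2+ m rewrite φ-nonsquare (2 ℕ.+ m ℕ.* 3) (λ k → square≢2+ k m) | dilate₃-2+ (dilate₃ φ) m =
        ≡⇒≡₃ (ℤₚ.*-zeroʳ (+ (2 ℕ.+ m ℕ.* 3)))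

alternate-⊖ : ∀ f → alternate (⊖ f) ≗ ⊖ alternate f
alternate-⊖ f n = ≡.sym (ℤₚ.neg-distribʳ-* (sign n) (f n))

alternate-⊕ : ∀ f g → alternate (f ⊕ g) ≗ alternate f ⊕ alternate g
alternate-⊕ f g n = ℤₚ.*-distribˡ-+ (sign n) (f n) (g n)

alternate-one : alternate one ≗ one
alternate-one zero    = ≡.refl
alternate-one (suc n) = ℤₚ.*-zeroʳ (sign (suc n))

cube≡₃ : ∀ c → c ℤ.* (c ℤ.* c) ≡₃ c
cube≡₃ (+ n) = nonnegative n
  where
  expand : ∀ a → (+ 1 ℤ.+ a) ℤ.* ((+ 1 ℤ.+ a) ℤ.* (+ 1 ℤ.+ a)) ℤ.- (+ 1 ℤ.+ a ℤ.* (a ℤ.* a))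
    ≡ (a ℤ.* a ℤ.+ a) ℤ.* + 3
  expand = ℤSolver.solve-∀
  nonnegative : ∀ n → + n ℤ.* (+ n ℤ.* + n) ≡₃ + n
  nonnegative zero    = ≡₃-refl
  nonnegative (suc n) = ≡₃-trans (mod₃ (divides (+ n ℤ.* + n ℤ.+ + n) (expand (+ n))))
    (+-cong₃ (≡₃-refl {+ 1}) (nonnegative n))
cube≡₃ -[1+ n ] = ≡₃-trans (≡⇒≡₃ (negate (+ suc n))) (-‿cong₃ (cube≡₃ (+ suc n)))
  where
  negate : ∀ a → ℤ.- a ℤ.* (ℤ.- a ℤ.* ℤ.- a) ≡ ℤ.- (a ℤ.* (a ℤ.* a))
  negate = ℤSolver.solve-∀

·-zero : ∀ f g n → (∀ i j → i ℕ.+ j ≡ n → f i ℤ.* g j ≡ + 0) → (f · g) n ≡ + 0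
·-zero f g zero    p = p 0 0 ≡.refl
·-zero f g (suc n) p = ≡.trans (·-suc f g n)
  (cong₂ ℤ._+_ (p 0 (suc n) ≡.refl) (·-zero (tail f) g n (λ i j e → p (suc i) j (cong suc e))))

-- Relations between A, B and the partial products

module ThetaSeries (K : ℕ) where

  open Mod₃ K
  open Relation.Binary.Reasoning.Setoid setoid

  exact : ∀ {f g} → f ≗ g → f ≈ g
  exact p n _ = ≡⇒≡₃ (p n)

  q^≗monomial : ∀ k → q ^ k ≗ monomial k
  q^≗monomial zero    n       = ≡.refl
  q^≗monomial (suc k) zero    = ≡.refl
  q^≗monomial (suc k) (suc n) = ≡.trans (q·-suc (q ^ k) n) (q^≗monomial k n)

  q^K≈0 : q ^ K ≈ 𝟘
  q^K≈0 n n<K = ≡⇒≡₃ (≡.trans (q^≗monomial K n) (monomial-≢ (λ K≡n → ℕₚ.<-irrefl (≡.sym K≡n) n<K)))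

  private
    ⊖q·-suc : ∀ f n → ((⊖ q) · f) (suc n) ≡ ℤ.- f n
    ⊖q·-suc f n = ≡.trans (⊖-· q f (suc n)) (cong ℤ.-_ (q·-suc f n))

  alternate-q^ : ∀ k → alternate (q ^ k) ≗ (⊖ q) ^ k
  alternate-q^ zero    n       = alternate-one n
  alternate-q^ (suc k) zero    = ≡.refl
  alternate-q^ (suc k) (suc n) = ≡R.begin
    ℤ.- sign n ℤ.* (q · (q ^ k)) (suc n)   ≡R.≡⟨ cong (ℤ.- sign n ℤ.*_) (q·-suc (q ^ k) n) ⟩
    ℤ.- sign n ℤ.* (q ^ k) n             ≡R.≡⟨ ℤₚ.neg-distribˡ-* (sign n) ((q ^ k) n) ⟨
    ℤ.- (sign n ℤ.* (q ^ k) n)           ≡R.≡⟨ cong ℤ.-_ (alternate-q^ k n) ⟩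
    ℤ.- ((⊖ q) ^ k) n                    ≡R.≡⟨ ⊖q·-suc ((⊖ q) ^ k) n ⟨
    ((⊖ q) · ((⊖ q) ^ k)) (suc n)          ≡R.∎
    where module ≡R = ≡.≡-Reasoning

  dilate₂-⊖q^ : ∀ k → dilate₂ ((⊖ q) ^ k) ≗ (⊖ (q · q)) ^ k
  dilate₂-⊖q^ zero    n             = dilate₂-one n
  dilate₂-⊖q^ (suc k) 0             = ≡.refl
  dilate₂-⊖q^ (suc k) 1             = ≡.sym (·-suc (⊖ (q · q)) ((⊖ (q · q)) ^ k) 0)
  dilate₂-⊖q^ (suc k) (suc (suc n)) = ≡R.begin
    dilate₂ (tail ((⊖ q) · ((⊖ q) ^ k))) n   ≡R.≡⟨ dilate₂-ext (⊖q·-suc ((⊖ q) ^ k)) n ⟩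
    dilate₂ (⊖ ((⊖ q) ^ k)) n              ≡R.≡⟨ dilate₂-⊖ ((⊖ q) ^ k) n ⟩
    ℤ.- dilate₂ ((⊖ q) ^ k) n              ≡R.≡⟨ cong ℤ.-_ (dilate₂-⊖q^ k n) ⟩
    ℤ.- y n                                ≡R.≡⟨ cong ℤ.-_ (≡.trans (q·-suc (q · y) (suc n)) (q·-suc y n)) ⟨
    ℤ.- (q · (q · y)) (suc (suc n))        ≡R.≡⟨ cong ℤ.-_ (·-assoc q q y (suc (suc n))) ⟨
    ℤ.- ((q · q) · y) (suc (suc n))        ≡R.≡⟨ ⊖-· (q · q) y (suc (suc n)) ⟨
    ((⊖ (q · q)) · y) (suc (suc n))        ≡R.∎
    where
    module ≡R = ≡.≡-Reasoning
    y = (⊖ (q · q)) ^ k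

  -- Carries theta sums along an additive operator that sends powers of `x` to powers of `y`; it
  -- serves for q ↦ -q and q ↦ q².
  thetaSum-map : ∀ {x y} (L : Series → Series) →
    (∀ f g → L (f ⊕ g) ≗ L f ⊕ L g) → (∀ f → L (⊖ f) ≗ ⊖ L f) → L 𝟘 ≗ 𝟘 →
    (∀ k → L (x ^ k) ≗ y ^ k) → ∀ n → L (thetaSum x n) ≗ thetaSum y n
  thetaSum-map {x} {y} L L-⊕ L-⊖ L-𝟘 L-^ n i = ≡.trans (L-⊕ one (⊖ squareSum x n) i)
    (cong₂ ℤ._+_ (L-^ 0 i) (≡.trans (L-⊖ (squareSum x n) i) (cong ℤ.-_ (squareSum-map n i))))
    where
    squareSum-map : ∀ n → L (squareSum x n) ≗ squareSum y n
    squareSum-map zero    i = L-𝟘 i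
    squareSum-map (suc n) i = ≡.trans (L-⊕ (squareSum x n) (x ^ (suc n ℕ.* suc n)) i)
      (cong₂ ℤ._+_ (squareSum-map n i) (L-^ (suc n ℕ.* suc n) i))

  private
    squareSum-none : ∀ n N → (∀ j → suc j ≤ n → suc j ℕ.* suc j ≢ N) → squareSum q n N ≡ + 0
    squareSum-none zero    N p = ≡.refl
    squareSum-none (suc n) N p = cong₂ ℤ._+_
      (squareSum-none n N (λ j j<n → p j (ℕₚ.m≤n⇒m≤1+n j<n)))
      (≡.trans (q^≗monomial (suc n ℕ.* suc n) N) (monomial-≢ (p n ℕₚ.≤-refl)))

    square-< : ∀ {i j} → i < j → suc i ℕ.* suc i < suc j ℕ.* suc j
    square-< i<j = ℕₚ.*-mono-< (s≤s i<j) (s≤s i<j)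

    squareSum-one : ∀ n i → suc i ≤ n → squareSum q n (suc i ℕ.* suc i) ≡ + 1
    squareSum-one (suc n) i i<n with ℕₚ.m≤n⇒m<n∨m≡n i<n
    ... | inj₁ (s≤s i<n′) = cong₂ ℤ._+_ (squareSum-one n i i<n′)
            (≡.trans (q^≗monomial (suc n ℕ.* suc n) (suc i ℕ.* suc i))
              (monomial-≢ (λ e → ℕₚ.<-irrefl (≡.sym e) (square-< i<n′))))
    ... | inj₂ ≡.refl = cong₂ ℤ._+_
            (squareSum-none n (suc n ℕ.* suc n) (λ j j<n e → ℕₚ.<-irrefl e (square-< j<n)))
            (≡.trans (q^≗monomial (suc n ℕ.* suc n) (suc n ℕ.* suc n)) (monomial-≡ (suc n ℕ.* suc n)))

  -- A square j² below K satisfies j ≤ j² ≤ n, so the finite sum contains it.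
  φ≈thetaSum : ∀ n → K ≤ suc n → φ ≈ thetaSum q n
  φ≈thetaSum n K≤1+n zero    _ = ≡⇒≡₃ (≡.sym (cong (λ z → + 1 ℤ.- z) (squareSum-none n 0 (λ _ _ ()))))
  φ≈thetaSum n K≤1+n (suc N) N<K = ≡⇒≡₃ (coefficient (isSquare? (suc N)))
    where
    coefficient : Dec (∃ λ j → j < suc (suc N) × j ℕ.* j ≡ suc N) → φ (suc N) ≡ + 0 ℤ.- squareSum q n (suc N)
    coefficient (yes (suc j , _ , e)) = ≡.trans (≡.trans (cong φ (≡.sym e)) (φ-square j))
      (cong (λ z → + 0 ℤ.- z) (≡.sym (≡.trans (cong (squareSum q n) (≡.sym e)) (squareSum-one n j
        (ℕₚ.≤-trans (ℕₚ.m≤m*n (suc j) (suc j)) (≡.subst (_≤ n) (≡.sym e) (ℕ.s≤s⁻¹ (ℕₚ.≤-trans N<K K≤1+n))))))))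
    coefficient (no ¬p) = ≡.trans (φ-nonsquare (suc N) nonsquare)
      (cong (λ z → + 0 ℤ.- z) (≡.sym (squareSum-none n (suc N) (λ j _ → nonsquare (suc j)))))
      where
      nonsquare : ∀ j → j ℕ.* j ≢ suc N
      nonsquare zero    ()
      nonsquare (suc j) e = ¬p (suc j , s≤s (≡.subst (suc j ≤_) e (ℕₚ.m≤m*n (suc j) (suc j))) , e)

  alternate-cong : ∀ {f g} → f ≈ g → alternate f ≈ alternate g
  alternate-cong p n n<K = *-cong₃ (≡₃-refl {sign n}) (p n n<K)

  dilate₂-cong : ∀ {f g} → f ≈ g → dilate₂ f ≈ dilate₂ g
  dilate₂-cong p n n<K = dilate₂-cong₃ n
    (λ i 2i≤n → p i (ℕₚ.≤-<-trans (ℕₚ.≤-trans (ℕₚ.m≤m+n i i) 2i≤n) n<K))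

  θ-cong : ∀ {f g} → f ≈ g → θ f ≈ θ g
  θ-cong p n n<K = *-cong₃ (≡₃-refl {+ n}) (p n n<K)

  alternate-φ≈thetaSum : ∀ n → K ≤ suc n → alternate φ ≈ thetaSum (⊖ q) n
  alternate-φ≈thetaSum n K≤ = trans (alternate-cong (φ≈thetaSum n K≤))
    (exact (thetaSum-map alternate alternate-⊕ alternate-⊖ (λ i → ℤₚ.*-zeroʳ (sign i)) alternate-q^ n))

  dilate₂-alternate-φ≈thetaSum : ∀ n → K ≤ suc n → dilate₂ (alternate φ) ≈ thetaSum (⊖ (q · q)) n
  dilate₂-alternate-φ≈thetaSum n K≤ = trans (dilate₂-cong (alternate-φ≈thetaSum n K≤))
    (exact (thetaSum-map dilate₂ dilate₂-⊕ dilate₂-⊖ dilate₂-𝟘 dilate₂-⊖q^ n))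

  φ·alternate-φ : φ · alternate φ ≈ dilate₂ (alternate φ) · dilate₂ (alternate φ)
  φ·alternate-φ = begin
    φ · alternate φ
      -- The number of terms must satisfy K ≤ n + 1 and K < 2 n; n = K + 1 does so even for K = 0.
      ≈⟨ *-cong (φ≈thetaSum (suc K) K≤) (alternate-φ≈thetaSum (suc K) K≤) ⟩
    thetaSum q (suc K) · thetaSum (⊖ q) (suc K)
      ≈⟨ thetaSum-neg q^K≈0 {suc K} (s≤s (ℕₚ.m≤m+n K (suc K))) ⟩
    thetaSum (⊖ (q · q)) (suc K) · thetaSum (⊖ (q · q)) (suc K)
      ≈⟨ *-cong (dilate₂-alternate-φ≈thetaSum (suc K) K≤) (dilate₂-alternate-φ≈thetaSum (suc K) K≤) ⟨
    dilate₂ (alternate φ) · dilate₂ (alternate φ) ∎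
    where
    K≤ : K ≤ suc (suc K)
    K≤ = ℕₚ.≤-trans (ℕₚ.n≤1+n K) (ℕₚ.n≤1+n (suc K))

  -- With f = c + q g, the cube is c³ + q³ g³; here c³ = c by Fermat, and g³ is handled by recursion
  -- on the index.
  frobenius : ∀ f → f ^ 3 ≈ dilate₃ f
  frobenius f n n<K = ≡₃-trans (≡₃-trans (^-congˡ 3 head⊕tail n n<K)
    (cube-split (f 0 • one) q (tail f) n n<K)) (coefficient n n<K)
    where
    head⊕tail : f ≈ (f 0 • one) ⊕ (q · tail f)
    head⊕tail zero    _ = ≡⇒≡₃ (≡.sym (≡.trans (ℤₚ.+-identityʳ _) (ℤₚ.*-identityʳ (f 0))))
    head⊕tail (suc i) _ = ≡⇒≡₃ (≡.sym
      (≡.trans (cong₂ ℤ._+_ (ℤₚ.*-zeroʳ (f 0)) (q·-suc (tail f) i)) (ℤₚ.+-identityˡ _)))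
    constant·constant : ∀ c g → (c • one) · g ≗ c • g
    constant·constant c g i = ≡.trans (•-· c one g i) (cong (c ℤ.*_) (·-identityˡ g i))
    constant³ : ∀ c i → ((c • one) ^ 3) i ≡ c ℤ.* (c ℤ.* (c ℤ.* one i))
    constant³ c i = ≡.trans (constant·constant c ((c • one) ^ 2) i) (cong (c ℤ.*_)
      (≡.trans (constant·constant c ((c • one) ^ 1) i) (cong (c ℤ.*_) (constant·constant c one i))))
    constant³-suc : ∀ c i → ((c • one) ^ 3) (suc i) ≡ + 0
    constant³-suc c i = ≡.trans (constant³ c (suc i)) (zeros c)
      where
      zeros : ∀ c → c ℤ.* (c ℤ.* (c ℤ.* + 0)) ≡ + 0
      zeros = ℤSolver.solve-∀
    t³ = tail f ^ 3
    coefficient : ∀ i → i < K → (((f 0 • one) ^ 3) ⊕ (q · (q · (q · t³)))) i ≡₃ dilate₃ f i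
    coefficient 0 _ = ≡₃-trans (≡⇒≡₃ (≡.trans (ℤₚ.+-identityʳ _) (≡.trans (constant³ (f 0) 0)
      (cong (λ z → f 0 ℤ.* (f 0 ℤ.* z)) (ℤₚ.*-identityʳ (f 0)))))) (cube≡₃ (f 0))
    coefficient 1 _ = ≡⇒≡₃ (cong₂ ℤ._+_ (constant³-suc (f 0) 0) (q·-suc (q · (q · t³)) 0))
    coefficient 2 _ = ≡⇒≡₃ (cong₂ ℤ._+_ (constant³-suc (f 0) 1)
      (≡.trans (q·-suc (q · (q · t³)) 1) (q·-suc (q · t³) 0)))
    coefficient (suc (suc (suc i))) i<K = ≡₃-trans
      (≡⇒≡₃ (≡.trans (cong₂ ℤ._+_ (constant³-suc (f 0) (suc (suc i)))
        (≡.trans (q·-suc (q · (q · t³)) (suc (suc i))) (≡.trans (q·-suc (q · t³) (suc i)) (q·-suc t³ i))))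
        (ℤₚ.+-identityˡ _)))
      (frobenius (tail f) i (ℕₚ.≤-<-trans (ℕₚ.m≤n+m i 3) i<K))

  -- A series with constant term 1 is a unit; the coefficients of g vanish one after the other.
  cancel-zero : ∀ u g → u 0 ≡ + 1 → u · g ≈ 𝟘 → g ≈ 𝟘
  cancel-zero u g u₀≡1 p n n<K = below n n ℕₚ.≤-refl n<K
    where
    scale : ∀ i → u 0 ℤ.* g i ≡ g i
    scale i = ≡.trans (cong (ℤ._* g i) u₀≡1) (ℤₚ.*-identityˡ (g i))
    below : ∀ m i → i ≤ m → i < K → g i ≡₃ + 0
    below m       zero    _         0<K = ≡₃-trans (≡⇒≡₃ (≡.sym (scale 0))) (p 0 0<K)
    below (suc m) (suc i) (s≤s i≤m) i<K = ≡₃-trans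
      (≡⇒≡₃ (≡.trans (≡.sym (scale (suc i))) (≡.sym (ℤₚ.+-identityʳ _))))
      (≡₃-trans (+-cong₃ (≡₃-refl {u 0 ℤ.* g (suc i)}) (≡₃-sym rest)) (≡₃-trans (≡⇒≡₃ (≡.sym (·-suc u g i))) (p (suc i) i<K)))
      where
      rest : (tail u · g) i ≡₃ + 0
      rest = ≡₃-trans
        (·-cong₃ {tail u} {tail u} {g} {𝟘} i (λ _ _ → ≡₃-refl)
          (λ j j≤i → below m j (ℕₚ.≤-trans j≤i i≤m) (ℕₚ.≤-<-trans j≤i (ℕₚ.≤-<-trans (ℕₚ.n≤1+n i) i<K))))
        (≡⇒≡₃ (≡.trans (·-comm (tail u) 𝟘 i) (·-zeroˡ (tail u) i)))

  -- As 4 = 1 modulo 3, θ(f⁴) = f³ θ(f) = f⁴ - f¹².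
  θ-fourth : ∀ f → θ f ≈ f ⊕ (⊖ (f ^ 9)) → θ (f ^ 4) ≈ (f ^ 4) ⊕ (⊖ ((f ^ 4) ^ 3))
  θ-fourth f θf = begin
    θ (f ^ 4)
      ≈⟨ power-rule 3 (power-rule 2 (power-rule 1 (power-rule 0 θ-one))) ⟩
    (f′ · (f ^ 3)) ⊕ (f · ((f′ · (f ^ 2)) ⊕ (f · ((f′ · (f ^ 1)) ⊕ (f · ((f′ · one) ⊕ (f · 𝟘)))))))
      ≈⟨ solve 1 (λ f →
           (f :- f :^ 9) :* f :^ 3 :+ f :* ((f :- f :^ 9) :* f :^ 2 :+ f :* ((f :- f :^ 9) :* f :^ 1
             :+ f :* ((f :- f :^ 9) :* :1 :+ f :* con 0₃)))
           := f :^ 4 :- (f :^ 4) :^ 3) refl f ⟩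
    (f ^ 4) ⊕ (⊖ ((f ^ 4) ^ 3)) ∎
    where
    f′ = f ⊕ (⊖ (f ^ 9))
    θ-one : θ one ≈ 𝟘
    θ-one = exact λ where
      zero    → ≡.refl
      (suc n) → ℤₚ.*-zeroʳ (+ suc n)
    power-rule : ∀ k {g} → θ (f ^ k) ≈ g → θ (f ^ suc k) ≈ (f′ · (f ^ k)) ⊕ (f · g)
    power-rule k p = trans (exact (θ-· f (f ^ k))) (+-cong (*-congʳ θf) (*-congˡ p))

  ninth : ∀ f → dilate₃ (dilate₃ f) ≈ f ^ 9
  ninth f = begin
    dilate₃ (dilate₃ f)   ≈⟨ frobenius (dilate₃ f) ⟨
    dilate₃ f ^ 3         ≈⟨ ^-congˡ 3 (frobenius f) ⟨
    (f ^ 3) ^ 3           ≈⟨ solve 1 (λ f → (f :^ 3) :^ 3 := f :^ 9) refl f ⟩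
    f ^ 9                 ∎

  θ-φ≈ : θ φ ≈ φ ⊕ (⊖ (φ ^ 9))
  θ-φ≈ = trans (λ n _ → θ-φ n) (+-congˡ {φ} (-‿cong (ninth φ)))

  θ-alternate-φ : θ (alternate φ) ≈ alternate φ ⊕ (⊖ (alternate φ ^ 9))
  θ-alternate-φ = begin
    θ (alternate φ)
      ≈⟨ exact (θ-alternate φ) ⟩
    alternate (θ φ)
      ≈⟨ alternate-cong (λ n _ → θ-φ n) ⟩
    alternate (φ ⊕ (⊖ dilate₃ (dilate₃ φ)))
      ≈⟨ exact (λ n → ≡.trans (alternate-⊕ φ (⊖ dilate₃ (dilate₃ φ)) n)
           (cong (ℤ._+_ (alternate φ n)) (alternate-⊖ (dilate₃ (dilate₃ φ)) n))) ⟩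
    alternate φ ⊕ (⊖ alternate (dilate₃ (dilate₃ φ)))
      ≈⟨ +-congˡ {alternate φ} (-‿cong (exact (λ n →
           ≡.trans (dilate₃-ext (dilate₃-alternate φ) n) (dilate₃-alternate (dilate₃ φ) n)))) ⟨
    alternate φ ⊕ (⊖ dilate₃ (dilate₃ (alternate φ)))
      ≈⟨ +-congˡ {alternate φ} (-‿cong (ninth (alternate φ))) ⟩
    alternate φ ⊕ (⊖ (alternate φ ^ 9)) ∎

  A B : Series
  A = φ ^ 4
  B = alternate φ ^ 4

  dilate₂-^ : ∀ f k → dilate₂ (f ^ k) ≈ dilate₂ f ^ k
  dilate₂-^ f zero    = exact dilate₂-one
  dilate₂-^ f (suc k) = trans (exact (dilate₂-· f (f ^ k))) (*-congˡ (dilate₂-^ f k))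

  A·B≈dilate₂-B² : A · B ≈ dilate₂ B · dilate₂ B
  A·B≈dilate₂-B² = begin
    (φ ^ 4) · (φ⁻ ^ 4)         ≈⟨ solve 2 (λ a b → a :^ 4 :* b :^ 4 := (a :* b) :^ 4) refl φ φ⁻ ⟩
    (φ · φ⁻) ^ 4               ≈⟨ ^-congˡ 4 φ·alternate-φ ⟩
    (w · w) ^ 4                ≈⟨ solve 1 (λ w → (w :* w) :^ 4 := w :^ 4 :* w :^ 4) refl w ⟩
    (w ^ 4) · (w ^ 4)          ≈⟨ *-cong (dilate₂-^ φ⁻ 4) (dilate₂-^ φ⁻ 4) ⟨
    dilate₂ B · dilate₂ B      ∎
    where
    φ⁻ = alternate φ
    w = dilate₂ φ⁻

  -- θ(q ↦ q²) brings out the factor 2 = -1, so A B = (dilate₂ B)² becomes a second relation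
  -- between A and B.
  B≈-1-A : B ≈ (⊖ one) ⊕ (⊖ A)
  B≈-1-A = zero-difference (trans
    (solve 2 (λ a b → b :- (:- :1 :- a) := a :+ b :+ :1) refl A B)
    -- A + B - 1 has constant term 1 and can be cancelled. The other factor A + B + 1 has constant
    -- term 3, and this fixes the sign in (A + B)² = 1.
    (cancel-zero (A ⊕ B ⊕ (⊖ one)) _ ≡.refl
    (cancel-zero (A · B) _ ≡.refl (sum-squared A B (begin
      ((A ⊕ (⊖ (A ^ 3))) · B) ⊕ (A · (B ⊕ (⊖ (B ^ 3))))
        ≈⟨ +-cong (*-congʳ θA) (*-congˡ θB) ⟨
      (θ A · B) ⊕ (A · θ B)
        ≈⟨ exact (θ-· A B) ⟨
      θ (A · B)
        ≈⟨ θ-cong A·B≈dilate₂-B² ⟩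
      θ (w · w)
        ≈⟨ exact (θ-· w w) ⟩
      (θ w · w) ⊕ (w · θ w)
        ≈⟨ +-cong (*-congʳ θw) (*-congˡ θw) ⟩
      ((w ^ 3 ⊕ (⊖ w)) · w) ⊕ (w · (w ^ 3 ⊕ (⊖ w)))
        ≈⟨ solve 1 (λ w → (w :^ 3 :- w) :* w :+ w :* (w :^ 3 :- w) := w :* w :- w :* w :* (w :* w)) refl w ⟩
      (w · w) ⊕ (⊖ ((w · w) · (w · w)))
        ≈⟨ +-cong A·B≈dilate₂-B² (-‿cong (*-cong A·B≈dilate₂-B² A·B≈dilate₂-B²)) ⟨
      (A · B) ⊕ (⊖ ((A · B) · (A · B))) ∎)))))
    where
    w = dilate₂ B
    θA = θ-fourth φ θ-φ≈
    θB = θ-fourth (alternate φ) θ-alternate-φ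
    θw : θ w ≈ w ^ 3 ⊕ (⊖ w)
    θw = begin
      θ (dilate₂ B)
        ≈⟨ exact (θ-dilate₂ B) ⟩
      (+ 2) • dilate₂ (θ B)
        ≈⟨ (λ n _ → mod₃ (divides (dilate₂ (θ B) n) (triple (dilate₂ (θ B) n)))) ⟩
      ⊖ dilate₂ (θ B)
        ≈⟨ -‿cong (dilate₂-cong θB) ⟩
      ⊖ dilate₂ (B ⊕ (⊖ (B ^ 3)))
        ≈⟨ -‿cong (exact (λ n → ≡.trans (dilate₂-⊕ B (⊖ (B ^ 3)) n) (cong (ℤ._+_ (w n)) (dilate₂-⊖ (B ^ 3) n)))) ⟩
      ⊖ (w ⊕ (⊖ dilate₂ (B ^ 3)))
        ≈⟨ -‿cong (+-congˡ {w} (-‿cong (dilate₂-^ B 3))) ⟩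
      ⊖ (w ⊕ (⊖ (w ^ 3)))
        ≈⟨ solve 1 (λ w → :- (w :- w :^ 3) := w :^ 3 :- w) refl w ⟩
      w ^ 3 ⊕ (⊖ w) ∎
      where
      triple : ∀ a → + 2 ℤ.* a ℤ.- ℤ.- a ≡ a ℤ.* + 3
      triple = ℤSolver.solve-∀

  -- From B = -(1 + A) comes B² = -B - A B = 1 + A - A B.
  A·B≈dilate₂ : A · B ≈ dilate₂ (one ⊕ A ⊕ (⊖ (A · B)))
  A·B≈dilate₂ = begin
    A · B                            ≈⟨ A·B≈dilate₂-B² ⟩
    dilate₂ B · dilate₂ B            ≈⟨ exact (dilate₂-· B B) ⟨
    dilate₂ (B · B)                  ≈⟨ dilate₂-cong B² ⟩
    dilate₂ (one ⊕ A ⊕ (⊖ (A · B)))  ∎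
    where
    B² : B · B ≈ one ⊕ A ⊕ (⊖ (A · B))
    B² = begin
      B · B
        ≈⟨ *-cong B≈-1-A B≈-1-A ⟩
      ((⊖ one) ⊕ (⊖ A)) · ((⊖ one) ⊕ (⊖ A))
        ≈⟨ solve 1 (λ a → (:- :1 :- a) :* (:- :1 :- a) := :1 :+ a :- a :* (:- :1 :- a)) refl A ⟩
      one ⊕ A ⊕ (⊖ (A · ((⊖ one) ⊕ (⊖ A))))
        ≈⟨ +-congˡ {one ⊕ A} (-‿cong (*-congˡ B≈-1-A)) ⟨
      one ⊕ A ⊕ (⊖ (A · B)) ∎

  A≈φ·dilate₃-φ : A ≈ dilate₃ φ · φ
  A≈φ·dilate₃-φ = trans (solve 1 (λ a → a :^ 4 := a :^ 3 :* a) refl φ) (*-congʳ (frobenius φ))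

  -- A B = -A - A² eliminates A², leaving A, A B and a series in q³, each of which has a known image
  -- under U.
  A²·B : A · (A · B) ≈ A ⊕ (A · B) ⊕ (⊖ dilate₃ A)
  A²·B = begin
    A · (A · B)
      ≈⟨ *-congˡ (*-congˡ B≈-1-A) ⟩
    A · (A · ((⊖ one) ⊕ (⊖ A)))
      ≈⟨ solve 1 (λ a → a :* (a :* (:- :1 :- a)) := a :+ a :* (:- :1 :- a) :- a :^ 3) refl A ⟩
    A ⊕ (A · ((⊖ one) ⊕ (⊖ A))) ⊕ (⊖ (A ^ 3))
      ≈⟨ +-cong (+-congˡ {A} (*-congˡ (sym B≈-1-A))) (-‿cong (frobenius A)) ⟩
    A ⊕ (A · B) ⊕ (⊖ dilate₃ A) ∎

  partialProd-oddProduct : ∀ n →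
    partialProd n · (oddProduct q n ^ 8) ≈ oddProduct (⊖ q) n ^ 8
  partialProd-oddProduct zero    = solve 0 (:1 :* :1 :^ 8 := :1 :^ 8) refl
  partialProd-oddProduct (suc k) = begin
    (factor (2 ℕ.* k ℕ.+ 1) · partialProd k) · (((one ⊕ y) · oddProduct q k) ^ 8)
      ≡⟨ cong (λ m → (factor m · partialProd k) · (((one ⊕ y) · oddProduct q k) ^ 8)) (exponent k) ⟩
    (factor m · partialProd k) · (((one ⊕ y) · oddProduct q k) ^ 8)
      ≈⟨ solve 4 (λ a b c d → a :* b :* (c :* d) :^ 8 := (a :* c :^ 8) :* (b :* d :^ 8))
           refl (factor m) (partialProd k) (one ⊕ y) (oddProduct q k) ⟩
    (factor m · ((one ⊕ y) ^ 8)) · (partialProd k · (oddProduct q k ^ 8))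
      ≈⟨ *-cong (trans (*-congʳ factor≈) (factor-cancel y inverse⁺ inverse⁻)) (partialProd-oddProduct k) ⟩
    ((one ⊕ (⊖ y)) ^ 8) · (oddProduct (⊖ q) k ^ 8)
      ≈⟨ solve 2 (λ a b → a :^ 8 :* b :^ 8 := (a :* b) :^ 8) refl (one ⊕ (⊖ y)) (oddProduct (⊖ q) k) ⟩
    ((one ⊕ (⊖ y)) · oddProduct (⊖ q) k) ^ 8
      ≈⟨ ^-congˡ 8 (*-congʳ {oddProduct (⊖ q) k} (+-congˡ {one} ⊖y≈)) ⟩
    ((one ⊕ ((⊖ q) · (((⊖ q) · (⊖ q)) ^ k))) · oddProduct (⊖ q) k) ^ 8 ∎
    where
    m = suc (k ℕ.+ k)
    y = q · ((q · q) ^ k)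
    exponent : ∀ k → 2 ℕ.* k ℕ.+ 1 ≡ suc (k ℕ.+ k)
    exponent = solve-∀
    ⊖y≈ : ⊖ y ≈ (⊖ q) · (((⊖ q) · (⊖ q)) ^ k)
    ⊖y≈ = trans (exact (λ n → ≡.sym (⊖-· q ((q · q) ^ k) n))) (*-congˡ {⊖ q} (^-congˡ k (sym (neg-square q))))
    y≈q^m : y ≈ q ^ m
    y≈q^m = *-congˡ {q} (trans (^-distrib-* q q k) (sym (^-homo-* q k k)))
    monomial-m : monomial m ≈ y
    monomial-m = trans (exact (λ n → ≡.sym (q^≗monomial m n))) (sym y≈q^m)
    monomial-9m : monomial (9 ℕ.* m) ≈ y ^ 9
    monomial-9m = begin
      monomial (9 ℕ.* m)   ≈⟨ exact (q^≗monomial (9 ℕ.* m)) ⟨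
      q ^ (9 ℕ.* m)        ≡⟨ cong (q ^_) (ℕₚ.*-comm 9 m) ⟩
      q ^ (m ℕ.* 9)        ≈⟨ ^-assocʳ q m 9 ⟨
      (q ^ m) ^ 9          ≈⟨ ^-congˡ 9 y≈q^m ⟨
      y ^ 9                ∎
    w = invOnePlus (9 ℕ.* m)
    z = invOneMinus m
    inverse⁺ : (one ⊕ y ^ 9) · w ≈ one
    inverse⁺ = trans (*-congʳ {w} (+-congˡ {one} (sym monomial-9m))) (exact (invOnePlus-inverse _))
    inverse⁻ : (one ⊕ (⊖ y)) · z ≈ one
    inverse⁻ = trans (*-congʳ {z} (+-congˡ {one} (-‿cong (sym monomial-m)))) (exact (invOneMinus-inverse (k ℕ.+ k)))
    factor≈ : factor m ≈ (one ⊕ y) · ((one ⊕ (⊖ (y ^ 9))) · (w · z))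
    factor≈ = *-cong (trans (exact (onePlus-monomial (k ℕ.+ k))) (+-congˡ {one} monomial-m))
      (*-congʳ {w · z} (trans (exact (oneMinus-monomial _)) (+-congˡ {one} (-‿cong monomial-9m))))

  partialProd·A : ∀ n → K ≤ suc n → K < n ℕ.+ n → partialProd n · A ≈ B
  partialProd·A n K≤1+n K<2n = begin
    partialProd n · (φ ^ 4)              ≈⟨ *-congˡ {partialProd n} (^-congˡ 4 (φ≈thetaSum n K≤1+n)) ⟩
    partialProd n · (thetaSum q n ^ 4)   ≈⟨ quotient-theta q^K≈0 {n} K<2n (partialProd-oddProduct n) ⟩
    thetaSum (⊖ q) n ^ 4                 ≈⟨ ^-congˡ 4 (alternate-φ≈thetaSum n K≤1+n) ⟨
    alternate φ ^ 4                      ∎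

-- Coefficients of index divisible by 3

-- A and B do not depend on the truncation order.
open ThetaSeries 0 using (A; B)

private
  A·B : Series
  A·B = A · B

-- U(φ(q³) φ) = φ U(φ) = φ φ(q³). The truncation order is chosen just above the index that is read
-- off.
section₃-A : ∀ n → A (n ℕ.* 3) ≡₃ A n
section₃-A n = ≡₃-trans (ThetaSeries.A≈φ·dilate₃-φ (suc (n ℕ.* 3)) (n ℕ.* 3) ℕₚ.≤-refl)
  (≡₃-trans (≡⇒≡₃ (≡.trans (section₃-dilate₃-· φ φ n) (≡.trans (·-comm φ (section₃ φ) n) (·-congˡ section₃-φ n))))
  (≡₃-sym (ThetaSeries.A≈φ·dilate₃-φ (suc n) n ℕₚ.≤-refl)))

-- With X = A·B and D = 1 + A - X, X is the dilation of D by 2, which commutes with section₃;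
-- hence section₃ X - X is minus its own dilation by 2, and vanishes.
section₃-A·B : ∀ n → A·B (n ℕ.* 3) ≡₃ A·B n
section₃-A·B n = below n n ℕₚ.≤-refl
  where
  D = one ⊕ A ⊕ (⊖ A·B)
  dilated : ∀ n → A·B n ≡₃ dilate₂ D n
  dilated n = ThetaSeries.A·B≈dilate₂ (suc n) n ℕₚ.≤-refl
  half-bound : ∀ {i m} → i ℕ.+ i ≤ suc m → i ≤ m
  half-bound {zero}  _         = z≤n
  half-bound {suc i} (s≤s i+i≤m) = ℕₚ.≤-trans (ℕₚ.m≤n+m (suc i) i) i+i≤m
  section₃-one : ∀ n → one (n ℕ.* 3) ≡ one n
  section₃-one zero    = ≡.refl
  section₃-one (suc n) = ≡.refl
  below : ∀ m n → n ≤ m → A·B (n ℕ.* 3) ≡₃ A·B n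
  -- U fixes the coefficient of index 0, and every later one reduces to an index at most half as
  -- large.
  below m       zero    _         = ≡₃-refl
  below (suc m) (suc n) (s≤s n≤m) = ≡₃-trans (dilated (suc n ℕ.* 3)) (≡₃-trans
    (≡₃-trans (≡⇒≡₃ (section₃-dilate₂ D (suc n)))
      (dilate₂-cong₃ {section₃ D} {D} (suc n) (λ i 2i≤1+n →
        +-cong₃ (+-cong₃ (≡⇒≡₃ (section₃-one i)) (section₃-A i))
                (-‿cong₃ (below m i (ℕₚ.≤-trans (half-bound 2i≤1+n) n≤m))))))
    (≡₃-sym (dilated (suc n))))

-- M ≥ 1 removes the constant -1 of B = -1 - A, and it gives 3 M + 1 < 2 (3 M), so that 3 M factors
-- suffice.
partialProd-section₃ : ∀ M → 1 ≤ M → partialProd (M ℕ.* 3) (M ℕ.* 3) ≡₃ ℤ.- A M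
partialProd-section₃ M@(suc M-1) _ = ≡₃-trans (section₃-S M ℕₚ.≤-refl)
  (≡₃-trans (ThetaSeries.B≈-1-A (suc M) M ℕₚ.≤-refl) (≡⇒≡₃ (ℤₚ.+-identityˡ (ℤ.- A M))))
  where
  S = partialProd (M ℕ.* 3)
  K = suc (M ℕ.* 3)
  -- Precision q^(3M+1) for S becomes precision q^(M+1) for U(S).
  module Low  = Mod₃ (suc M)
  module High = Mod₃ K
  S·A : S · A High.≈ B
  S·A = ThetaSeries.partialProd·A K (M ℕ.* 3) ℕₚ.≤-refl
    (s≤s (s≤s (s≤s (ℕₚ.≤-trans (ℕₚ.n≤1+n _) (ℕₚ.m≤n+m (suc (suc (suc (M-1 ℕ.* 3)))) (M-1 ℕ.* 3))))))
  S·A³ : dilate₃ A · S High.≈ A ⊕ A·B ⊕ (⊖ dilate₃ A)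
  S·A³ = begin
    dilate₃ A · S      ≈⟨ High.*-congʳ {S} (ThetaSeries.frobenius K A) ⟨
    (A High.^ 3) · S
      ≈⟨ High.solve 2 (λ a s → a High.:^ 3 High.:* s High.:= a High.:* (a High.:* (s High.:* a))) High.refl A S ⟩
    A · (A · (S · A))  ≈⟨ High.*-congˡ {A} (High.*-congˡ {A} S·A) ⟩
    A · A·B            ≈⟨ ThetaSeries.A²·B K ⟩
    A ⊕ A·B ⊕ (⊖ dilate₃ A) ∎
    where open Relation.Binary.Reasoning.Setoid High.setoid
  A·section₃-S : A · section₃ S Low.≈ A · B
  A·section₃-S n n≤M = ≡₃-trans (≡⇒≡₃ (≡.sym (section₃-dilate₃-· A S n)))
    (≡₃-trans (S·A³ (n ℕ.* 3) (s≤s (ℕₚ.*-monoˡ-≤ 3 (ℕ.s≤s⁻¹ n≤M))))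
    (≡₃-trans (+-cong₃ (+-cong₃ (section₃-A n) (section₃-A·B n)) (-‿cong₃ (≡⇒≡₃ (section₃-dilate₃ A n))))
    (≡⇒≡₃ (cancel (A n) (A·B n)))))
    where
    cancel : ∀ a b → a ℤ.+ b ℤ.- a ≡ b
    cancel = ℤSolver.solve-∀
  section₃-S : ∀ n → n ≤ M → section₃ S n ≡₃ B n
  section₃-S n n≤M = Low.zero-difference {section₃ S} {B}
    (ThetaSeries.cancel-zero (suc M) A (section₃ S ⊕ (⊖ B)) ≡.refl
      (Low.trans (Low.solve 3 (λ a s b → a Low.:* (s Low.:- b) Low.:= a Low.:* s Low.:- a Low.:* b) Low.refl A (section₃ S) B)
        (Low.difference-zero A·section₃-S))) n (s≤s n≤M)

private
  k≤k² : ∀ {k m} → k ℕ.* k ≡ m → k ≤ m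
  k≤k² {zero}  _      = z≤n
  k≤k² {suc k} ≡.refl = ℕₚ.m≤m*n (suc k) (suc k)

-- In A = φ(q³) φ, a nonzero term of degree M would come from exponents 3 y² and x² with sum M.
A-vanishes : ∀ M → (∀ x y → x ℕ.* x ℕ.+ y ℕ.* y ℕ.* 3 ≢ M) → A M ≡₃ + 0
A-vanishes M not-represented = ≡₃-trans (ThetaSeries.A≈φ·dilate₃-φ (suc M) M ℕₚ.≤-refl)
  (≡⇒≡₃ (·-zero (dilate₃ φ) φ M term-zero))
  where
  term-zero : ∀ i j → i ℕ.+ j ≡ M → dilate₃ φ i ℤ.* φ j ≡ + 0
  term-zero i j e with residue₃ i
  ... | 1+ m rewrite dilate₃-1+ φ m = ≡.refl
  ... | 2+ m rewrite dilate₃-2+ φ m = ≡.refl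
  ... | 0+ m with isSquare? m | isSquare? j
  ...   | no ¬p | _ rewrite section₃-dilate₃ φ m
            | φ-nonsquare m (λ k k²≡m → ¬p (k , s≤s (k≤k² k²≡m) , k²≡m)) = ≡.refl
  ...   | yes _ | no ¬p = ≡.trans (cong (dilate₃ φ (m ℕ.* 3) ℤ.*_)
              (φ-nonsquare j (λ k k²≡j → ¬p (k , s≤s (k≤k² k²≡j) , k²≡j)))) (ℤₚ.*-zeroʳ (dilate₃ φ (m ℕ.* 3)))
  ...   | yes (y , _ , ≡.refl) | yes (x , _ , ≡.refl) =
          ⊥-elim (not-represented x y (≡.trans (ℕₚ.+-comm (x ℕ.* x) (y ℕ.* y ℕ.* 3)) e))

S9bar-vanishes : ∀ M → 1 ≤ M → (∀ x y → x ℕ.* x ℕ.+ y ℕ.* y ℕ.* 3 ≢ M) → S9bar (M ℕ.* 3) ≡₃ + 0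
S9bar-vanishes M 1≤M p = ≡₃-trans (partialProd-section₃ M 1≤M) (-‿cong₃ (A-vanishes M p))

-- Primes dividing x² + 3y²

absorption : ∀ n k → suc k ℕ.* (suc n C suc k) ≡ suc n ℕ.* (n C k)
absorption zero zero = ≡.refl
absorption zero (suc k) = ≡.trans
  (cong (suc (suc k) ℕ.*_) (k>n⇒nCk≡0 {1} {suc (suc k)} (s≤s (s≤s z≤n))))
  (≡.trans (ℕₚ.*-zeroʳ (suc (suc k))) (≡.sym (cong (1 ℕ.*_) (k>n⇒nCk≡0 {0} {suc k} (s≤s z≤n)))))
absorption (suc n) zero = begin
  1 ℕ.* (suc (suc n) C 1)                     ≡⟨ cong (1 ℕ.*_) (nCk+nC[k+1]≡[n+1]C[k+1] (suc n) 0) ⟨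
  1 ℕ.* (1 ℕ.+ (suc n C 1))                   ≡⟨ ℕₚ.*-distribˡ-+ 1 1 (suc n C 1) ⟩
  1 ℕ.+ 1 ℕ.* (suc n C 1)                     ≡⟨ cong (1 ℕ.+_) (absorption n 0) ⟩
  suc (suc n) ℕ.* 1                           ∎
  where open ≡.≡-Reasoning
absorption (suc n) (suc k) = begin
  suc (suc k) ℕ.* (suc (suc n) C suc (suc k))
    ≡⟨ cong (suc (suc k) ℕ.*_) (nCk+nC[k+1]≡[n+1]C[k+1] (suc n) (suc k)) ⟨
  suc (suc k) ℕ.* ((suc n C suc k) ℕ.+ (suc n C suc (suc k)))
    ≡⟨ split (suc k) (suc n C suc k) (suc n C suc (suc k)) ⟩
  (suc n C suc k) ℕ.+ (suc k ℕ.* (suc n C suc k) ℕ.+ suc (suc k) ℕ.* (suc n C suc (suc k)))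
    ≡⟨ cong ((suc n C suc k) ℕ.+_) (cong₂ ℕ._+_ (absorption n k) (absorption n (suc k))) ⟩
  (suc n C suc k) ℕ.+ (suc n ℕ.* (n C k) ℕ.+ suc n ℕ.* (n C suc k))
    ≡⟨ cong ((suc n C suc k) ℕ.+_) (ℕₚ.*-distribˡ-+ (suc n) (n C k) (n C suc k)) ⟨
  (suc n C suc k) ℕ.+ suc n ℕ.* ((n C k) ℕ.+ (n C suc k))
    ≡⟨ cong (λ c → (suc n C suc k) ℕ.+ suc n ℕ.* c) (nCk+nC[k+1]≡[n+1]C[k+1] n k) ⟩
  suc (suc n) ℕ.* (suc n C suc k) ∎
  where
  open ≡.≡-Reasoning
  split : ∀ k a b → suc k ℕ.* (a ℕ.+ b) ≡ a ℕ.+ (k ℕ.* a ℕ.+ suc k ℕ.* b)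
  split = solve-∀

prime∣binomial : ∀ {p k} → Prime p → suc k < p → p ℕ∣.∣ p C suc k
prime∣binomial {suc n} {k} pr k<p
  with euclidsLemma (suc k) (suc n C suc k) pr (≡.subst (suc n ℕ∣.∣_) (≡.sym (absorption n k)) (ℕ∣.m∣m*n (n C k)))
... | inj₁ p∣1+k = ⊥-elim (ℕ∣.>⇒∤ k<p p∣1+k)
... | inj₂ p∣C   = p∣C

partialBinomial : ℕ → ℕ → ℕ → ℕ
partialBinomial a n zero    = 0
partialBinomial a n (suc k) = partialBinomial a n k ℕ.+ (n C k) ℕ.* a ℕ.^ k

partialBinomial-suc : ∀ a n k →
  partialBinomial a (suc n) (suc k) ≡ partialBinomial a n (suc k) ℕ.+ a ℕ.* partialBinomial a n k
partialBinomial-suc a n zero = cong (1 ℕ.+_) (≡.sym (ℕₚ.*-zeroʳ a))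
partialBinomial-suc a n (suc k) = begin
  partialBinomial a (suc n) (suc k) ℕ.+ (suc n C suc k) ℕ.* (a ℕ.* a ℕ.^ k)
    ≡⟨ cong₂ (λ s c → s ℕ.+ c ℕ.* (a ℕ.* a ℕ.^ k)) (partialBinomial-suc a n k) (≡.sym (nCk+nC[k+1]≡[n+1]C[k+1] n k)) ⟩
  (partialBinomial a n (suc k) ℕ.+ a ℕ.* partialBinomial a n k)
  ℕ.+ ((n C k) ℕ.+ (n C suc k)) ℕ.* (a ℕ.* a ℕ.^ k)
    ≡⟨ regroup a (partialBinomial a n (suc k)) (partialBinomial a n k) (n C k) (n C suc k) (a ℕ.^ k) ⟩
  (partialBinomial a n (suc k) ℕ.+ (n C suc k) ℕ.* (a ℕ.* a ℕ.^ k))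
  ℕ.+ a ℕ.* (partialBinomial a n k ℕ.+ (n C k) ℕ.* a ℕ.^ k) ∎
  where
  open ≡.≡-Reasoning
  regroup : ∀ a s t c d e →
    (s ℕ.+ a ℕ.* t) ℕ.+ (c ℕ.+ d) ℕ.* (a ℕ.* e) ≡ (s ℕ.+ d ℕ.* (a ℕ.* e)) ℕ.+ a ℕ.* (t ℕ.+ c ℕ.* e)
  regroup = solve-∀

binomial-theorem : ∀ a n → suc a ℕ.^ n ≡ partialBinomial a n (suc n)
binomial-theorem a zero    = ≡.refl
binomial-theorem a (suc n) = begin
  suc a ℕ.* suc a ℕ.^ n
    ≡⟨ cong (suc a ℕ.*_) (binomial-theorem a n) ⟩
  suc a ℕ.* partialBinomial a n (suc n)
    ≡⟨ cong (ℕ._+ a ℕ.* partialBinomial a n (suc n)) (ℕₚ.+-identityʳ (partialBinomial a n (suc n))) ⟨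
  (partialBinomial a n (suc n) ℕ.+ 0 ℕ.* a ℕ.^ suc n) ℕ.+ a ℕ.* partialBinomial a n (suc n)
    ≡⟨ cong (λ c → (partialBinomial a n (suc n) ℕ.+ c ℕ.* a ℕ.^ suc n) ℕ.+ a ℕ.* partialBinomial a n (suc n))
         (k>n⇒nCk≡0 (ℕₚ.n<1+n n)) ⟨
  partialBinomial a n (suc (suc n)) ℕ.+ a ℕ.* partialBinomial a n (suc n)
    ≡⟨ partialBinomial-suc a n (suc n) ⟨
  partialBinomial a (suc n) (suc (suc n)) ∎
  where open ≡.≡-Reasoning

-- Induction on a: p divides the inner terms of (1 + a)^p, which leaves 1 + a^p. Since a^p is at
-- least a, the quotient `c` is a natural number.
fermat : ∀ {p} → Prime p → ∀ a → ∃ λ c → a ℕ.^ p ≡ a ℕ.+ p ℕ.* c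
fermat {suc n} pr zero    = 0 , ≡.sym (ℕₚ.*-zeroʳ (suc n))
fermat {p@(suc n)} pr (suc a) with fermat pr a | inner n ℕₚ.≤-refl
  where
  inner : ∀ k → k < p → ∃ λ d → partialBinomial a p (suc k) ≡ 1 ℕ.+ p ℕ.* d
  inner zero    _     = 0 , cong suc (≡.sym (ℕₚ.*-zeroʳ p))
  inner (suc k) 1+k<p with inner k (ℕₚ.<-trans (ℕₚ.n<1+n k) 1+k<p) | prime∣binomial pr 1+k<p
  ... | d , e | ℕ∣.divides c eq = d ℕ.+ c ℕ.* a ℕ.^ suc k , (begin
    partialBinomial a p (suc k) ℕ.+ (p C suc k) ℕ.* a ℕ.^ suc k
      ≡⟨ cong₂ (λ s c → s ℕ.+ c ℕ.* a ℕ.^ suc k) e eq ⟩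
    1 ℕ.+ p ℕ.* d ℕ.+ c ℕ.* p ℕ.* a ℕ.^ suc k
      ≡⟨ regroup p d c (a ℕ.^ suc k) ⟩
    1 ℕ.+ p ℕ.* (d ℕ.+ c ℕ.* a ℕ.^ suc k) ∎)
    where
    open ≡.≡-Reasoning
    regroup : ∀ p d c e → 1 ℕ.+ p ℕ.* d ℕ.+ c ℕ.* p ℕ.* e ≡ 1 ℕ.+ p ℕ.* (d ℕ.+ c ℕ.* e)
    regroup = solve-∀
... | c , e | d , e′ = d ℕ.+ c , (begin
  suc a ℕ.^ p
    ≡⟨ binomial-theorem a p ⟩
  partialBinomial a p p ℕ.+ (p C p) ℕ.* a ℕ.^ p
    ≡⟨ cong₂ (λ s c → s ℕ.+ c ℕ.* a ℕ.^ p) e′ (nCn≡1 p) ⟩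
  1 ℕ.+ p ℕ.* d ℕ.+ 1 ℕ.* a ℕ.^ p
    ≡⟨ cong (λ z → 1 ℕ.+ p ℕ.* d ℕ.+ 1 ℕ.* z) e ⟩
  1 ℕ.+ p ℕ.* d ℕ.+ 1 ℕ.* (a ℕ.+ p ℕ.* c)
    ≡⟨ regroup p d c a ⟩
  suc a ℕ.+ p ℕ.* (d ℕ.+ c) ∎)
  where
  open ≡.≡-Reasoning
  regroup : ∀ p d c a → 1 ℕ.+ p ℕ.* d ℕ.+ 1 ℕ.* (a ℕ.+ p ℕ.* c) ≡ suc a ℕ.+ p ℕ.* (d ℕ.+ c)
  regroup = solve-∀

-- With e = 2 m + 1, (u + w)(u^(e+1) + w^(e+1)) = u w (u^e + w^e) + (u^(e+2) + w^(e+2)); this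
-- induction avoids subtraction.
odd-power-sum : ∀ {d} u w m → d ℕ∣.∣ u ℕ.+ w → d ℕ∣.∣ u ℕ.^ suc (m ℕ.+ m) ℕ.+ w ℕ.^ suc (m ℕ.+ m)
odd-power-sum {d} u w zero d∣u+w =
  ≡.subst (d ℕ∣.∣_) (cong₂ ℕ._+_ (≡.sym (ℕₚ.*-identityʳ u)) (≡.sym (ℕₚ.*-identityʳ w))) d∣u+w
odd-power-sum {d} u w (suc m) d∣u+w rewrite ℕₚ.+-suc m m = ℕ∣.∣m+n∣m⇒∣n
  (≡.subst (d ℕ∣.∣_) (expand u w (u ℕ.^ suc (m ℕ.+ m)) (w ℕ.^ suc (m ℕ.+ m)))
    (ℕ∣.∣m⇒∣m*n (u ℕ.* u ℕ.^ suc (m ℕ.+ m) ℕ.+ w ℕ.* w ℕ.^ suc (m ℕ.+ m)) d∣u+w))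
  (ℕ∣.∣n⇒∣m*n (u ℕ.* w) (odd-power-sum u w m d∣u+w))
  where
  expand : ∀ u w a b → (u ℕ.+ w) ℕ.* (u ℕ.* a ℕ.+ w ℕ.* b)
    ≡ u ℕ.* w ℕ.* (a ℕ.+ b) ℕ.+ (u ℕ.* (u ℕ.* a) ℕ.+ w ℕ.* (w ℕ.* b))
  expand = solve-∀

-- The hypotheses say 2p - 1 = 3 (2m + 1), so modulo p every number is the (2m+1)-th power of its cube.
module _ {p : ℕ} (pr : Prime p) (5≤p : 5 ≤ p)
  {k m : ℕ} (p≡1+k : p ≡ suc k) (3[2m+1]≡p+k : 3 ℕ.* suc (m ℕ.+ m) ≡ p ℕ.+ k) where

  private
    instance
      p≢0 : ℕ.NonZero p
      p≢0 = prime⇒nonZero pr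

    -- With k = p - 1, Fermat applied twice gives u^(2p-1) = u^p u^(p-1) ≡ u u^(p-1) = u^p ≡ u
    -- modulo p, with no case distinction on p dividing u.
    cube-root : ∀ u → ∃ λ c → (u ℕ.^ 3) ℕ.^ suc (m ℕ.+ m) ≡ u ℕ.+ p ℕ.* c
    cube-root u with fermat pr u
    ... | c , e = c ℕ.* u ℕ.^ k ℕ.+ c , (begin
      (u ℕ.^ 3) ℕ.^ suc (m ℕ.+ m)
        ≡⟨ ℕₚ.^-*-assoc u 3 (suc (m ℕ.+ m)) ⟩
      u ℕ.^ (3 ℕ.* suc (m ℕ.+ m))
        ≡⟨ cong (u ℕ.^_) 3[2m+1]≡p+k ⟩
      u ℕ.^ (p ℕ.+ k)
        ≡⟨ ℕₚ.^-distribˡ-+-* u p k ⟩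
      u ℕ.^ p ℕ.* u ℕ.^ k
        ≡⟨ cong (ℕ._* u ℕ.^ k) e ⟩
      (u ℕ.+ p ℕ.* c) ℕ.* u ℕ.^ k
        ≡⟨ ℕₚ.*-distribʳ-+ (u ℕ.^ k) u (p ℕ.* c) ⟩
      u ℕ.^ suc k ℕ.+ p ℕ.* c ℕ.* u ℕ.^ k
        ≡⟨ cong (λ z → u ℕ.^ z ℕ.+ p ℕ.* c ℕ.* u ℕ.^ k) p≡1+k ⟨
      u ℕ.^ p ℕ.+ p ℕ.* c ℕ.* u ℕ.^ k
        ≡⟨ cong (ℕ._+ p ℕ.* c ℕ.* u ℕ.^ k) e ⟩
      u ℕ.+ p ℕ.* c ℕ.+ p ℕ.* c ℕ.* u ℕ.^ k
        ≡⟨ regroup u p c (u ℕ.^ k) ⟩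
      u ℕ.+ p ℕ.* (c ℕ.* u ℕ.^ k ℕ.+ c) ∎)
      where
      open ≡.≡-Reasoning
      regroup : ∀ u p c v → u ℕ.+ p ℕ.* c ℕ.+ p ℕ.* c ℕ.* v ≡ u ℕ.+ p ℕ.* (c ℕ.* v ℕ.+ c)
      regroup = solve-∀

    p∤2 : ¬ p ℕ∣.∣ 2
    p∤2 = ℕ∣.>⇒∤ (ℕₚ.≤-trans (s≤s (s≤s (s≤s z≤n))) 5≤p)

    p∤3 : ¬ p ℕ∣.∣ 3
    p∤3 = ℕ∣.>⇒∤ (ℕₚ.≤-trans (s≤s (s≤s (s≤s (s≤s z≤n)))) 5≤p)

    p∤12 : ¬ p ℕ∣.∣ 12
    p∤12 p∣12 with euclidsLemma 2 6 pr p∣12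
    ... | inj₁ p∣2 = p∤2 p∣2
    ... | inj₂ p∣6 with euclidsLemma 2 3 pr p∣6
    ...   | inj₁ p∣2 = p∤2 p∣2
    ...   | inj₂ p∣3 = p∤3 p∣3

  -- (x + y)³ + (2y)³ = (x + 3y)(x² + 3y²), and p divides the sum of the bases with the sum of the cubes.
  ∣x+3y : ∀ x y → p ℕ∣.∣ x ℕ.* x ℕ.+ y ℕ.* y ℕ.* 3 → p ℕ∣.∣ x ℕ.+ y ℕ.* 3
  ∣x+3y x y p∣ with cube-root (x ℕ.+ y) | cube-root (2 ℕ.* y)
  ... | c , e | d , e′ = ℕ∣.∣m+n∣m⇒∣n
    (≡.subst (p ℕ∣.∣_) (≡.trans (cong₂ ℕ._+_ e e′) (regroup x y p c d))
      (odd-power-sum ((x ℕ.+ y) ℕ.^ 3) ((2 ℕ.* y) ℕ.^ 3) m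
        (≡.subst (p ℕ∣.∣_) (sum-of-cubes x y) (ℕ∣.∣n⇒∣m*n (x ℕ.+ y ℕ.* 3) p∣))))
    (ℕ∣.m∣m*n (c ℕ.+ d))
    where
    sum-of-cubes : ∀ x y → (x ℕ.+ y ℕ.* 3) ℕ.* (x ℕ.* x ℕ.+ y ℕ.* y ℕ.* 3)
      ≡ (x ℕ.+ y) ℕ.* ((x ℕ.+ y) ℕ.* ((x ℕ.+ y) ℕ.* 1))
        ℕ.+ (2 ℕ.* y) ℕ.* ((2 ℕ.* y) ℕ.* ((2 ℕ.* y) ℕ.* 1))
    sum-of-cubes = solve-∀
    regroup : ∀ x y p c d → (x ℕ.+ y ℕ.+ p ℕ.* c) ℕ.+ (2 ℕ.* y ℕ.+ p ℕ.* d)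
      ≡ p ℕ.* (c ℕ.+ d) ℕ.+ (x ℕ.+ y ℕ.* 3)
    regroup = solve-∀

  -- Modulo p, x = -3 y, so the form equals 12 y², and p ≥ 5 does not divide 12.
  inert : ∀ x y → p ℕ∣.∣ x ℕ.* x ℕ.+ y ℕ.* y ℕ.* 3 → p ℕ∣.∣ x × p ℕ∣.∣ y
  inert x y p∣ = p∣x , p∣y
    where
    p∣12y² : p ℕ∣.∣ 12 ℕ.* (y ℕ.* y)
    p∣12y² = ℕ∣.∣m+n∣m⇒∣n
      (≡.subst (p ℕ∣.∣_) (regroup x y) (ℕ∣.∣m∣n⇒∣m+n p∣ (ℕ∣.∣n⇒∣m*n (y ℕ.* 3) (∣x+3y x y p∣))))
      (ℕ∣.∣n⇒∣m*n x (∣x+3y x y p∣))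
      where
      regroup : ∀ x y → (x ℕ.* x ℕ.+ y ℕ.* y ℕ.* 3) ℕ.+ y ℕ.* 3 ℕ.* (x ℕ.+ y ℕ.* 3)
        ≡ x ℕ.* (x ℕ.+ y ℕ.* 3) ℕ.+ 12 ℕ.* (y ℕ.* y)
      regroup = solve-∀
    p∣y : p ℕ∣.∣ y
    p∣y = [ (λ p∣12 → ⊥-elim (p∤12 p∣12)) , (λ p∣y² → reduce (euclidsLemma y y pr p∣y²)) ]
      (euclidsLemma 12 (y ℕ.* y) pr p∣12y²)
    p∣x : p ℕ∣.∣ x
    p∣x = ℕ∣.∣m+n∣m⇒∣n (≡.subst (p ℕ∣.∣_) (ℕₚ.+-comm x (y ℕ.* 3)) (∣x+3y x y p∣)) (ℕ∣.∣m⇒∣m*n 3 p∣y)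

  -- Descent: p divides x and y, so p² divides the form, and dividing it out lowers α by one. At α =
  -- 0 it forces p to divide s.
  not-represented : ∀ α {s} → ¬ p ℕ∣.∣ s → ∀ x y →
    x ℕ.* x ℕ.+ y ℕ.* y ℕ.* 3 ≢ p ℕ.^ (2 ℕ.* α ℕ.+ 1) ℕ.* s
  not-represented α {s} p∤s x y e = descend α x y e (proj₁ p∣x×p∣y) (proj₂ p∣x×p∣y)
    where
    p∣form : p ℕ∣.∣ x ℕ.* x ℕ.+ y ℕ.* y ℕ.* 3
    p∣form = ≡.subst (p ℕ∣.∣_) (≡.sym (≡.trans e (cong (λ k → p ℕ.^ k ℕ.* s) (ℕₚ.+-comm (2 ℕ.* α) 1))))
      (ℕ∣.∣m⇒∣m*n s (ℕ∣.m∣m*n (p ℕ.^ (2 ℕ.* α))))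
    p∣x×p∣y : p ℕ∣.∣ x × p ℕ∣.∣ y
    p∣x×p∣y = inert x y p∣form
    p²-form : ∀ p x y →
      x ℕ.* p ℕ.* (x ℕ.* p) ℕ.+ y ℕ.* p ℕ.* (y ℕ.* p) ℕ.* 3 ≡ p ℕ.* (p ℕ.* (x ℕ.* x ℕ.+ y ℕ.* y ℕ.* 3))
    p²-form = solve-∀
    exponent : ∀ α → 2 ℕ.* suc α ℕ.+ 1 ≡ suc (suc (2 ℕ.* α ℕ.+ 1))
    exponent = solve-∀
    regroup : ∀ p a s → p ℕ.* (p ℕ.* a) ℕ.* s ≡ p ℕ.* (p ℕ.* (a ℕ.* s))
    regroup = solve-∀
    descend : ∀ α x y → x ℕ.* x ℕ.+ y ℕ.* y ℕ.* 3 ≡ p ℕ.^ (2 ℕ.* α ℕ.+ 1) ℕ.* s →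
      p ℕ∣.∣ x → p ℕ∣.∣ y → ⊥
    descend zero x y e (ℕ∣.divides x′ ≡.refl) (ℕ∣.divides y′ ≡.refl) = p∤s (ℕ∣.divides form (≡.trans
      (ℕₚ.*-cancelˡ-≡ s (p ℕ.* form) p (≡.trans (≡.sym (≡.trans e (cong (ℕ._* s) (ℕₚ.*-identityʳ p))))
        (p²-form p x′ y′)))
      (ℕₚ.*-comm p form)))
      where form = x′ ℕ.* x′ ℕ.+ y′ ℕ.* y′ ℕ.* 3
    descend (suc α) x y e (ℕ∣.divides x′ ≡.refl) (ℕ∣.divides y′ ≡.refl) = not-represented α p∤s x′ y′
      (ℕₚ.*-cancelˡ-≡ form _ p (ℕₚ.*-cancelˡ-≡ (p ℕ.* form) _ p (≡.trans (≡.sym (p²-form p x′ y′)) (≡.trans e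
        (≡.trans (cong (λ k → p ℕ.^ k ℕ.* s) (exponent α)) (regroup p (p ℕ.^ (2 ℕ.* α ℕ.+ 1)) s))))))
      where form = x′ ℕ.* x′ ℕ.+ y′ ℕ.* y′ ℕ.* 3

  -- Modulo p the number is 2 i, and p divides neither 2 nor i.
  odd-factor-coprime : ∀ n i → 1 ≤ i → i < p → ¬ p ℕ∣.∣ 2 ℕ.* p ℕ.* n ℕ.+ 2 ℕ.* i ℕ.+ p
  odd-factor-coprime n i@(suc _) _ i<p p∣ with euclidsLemma 2 i pr
    (ℕ∣.∣m+n∣m⇒∣n (≡.subst (p ℕ∣.∣_) (regroup p n i) p∣) (ℕ∣.m∣m*n (2 ℕ.* n ℕ.+ 1)))
    where
    regroup : ∀ p n i → 2 ℕ.* p ℕ.* n ℕ.+ 2 ℕ.* i ℕ.+ p ≡ p ℕ.* (2 ℕ.* n ℕ.+ 1) ℕ.+ 2 ℕ.* i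
    regroup = solve-∀
  ... | inj₁ p∣2 = p∤2 p∣2
  ... | inj₂ p∣i = ℕ∣.>⇒∤ i<p p∣i

open import Data.Nat using (ℕ; _+_; _*_; _^_; _≤_; _<_; _%_)
open import Data.Integer.Divisibility using (_∣_)

theorem3p5 : (p : ℕ) → Prime p → p % 6 ≡ 5 → (α n i : ℕ) → 1 ≤ i → i < p →
    (+ 3) ∣ S9bar (6 * p ^ (2 * α + 2) * n + (6 * i + 3 * p) * p ^ (2 * α + 1))
theorem3p5 p pr p%6≡5 α n i 1≤i i<p =
  ℤ∣.∣⇒∣ᵤ (≡.subst (λ k → + 3 ℤ∣.∣ S9bar k) (≡.sym index≡3M)
    (≡.subst (+ 3 ℤ∣.∣_) (ℤₚ.+-identityʳ (S9bar (M * 3))) (_≡₃_.3∣difference (S9bar-vanishes M 1≤M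
      (not-represented pr 5≤p {m = suc (t + t)} p≡5+6t 3[2m+1]≡p+k α
        (odd-factor-coprime pr 5≤p {m = suc (t + t)} p≡5+6t 3[2m+1]≡p+k n i 1≤i i<p))))))
  where
  t = p ℕ./ 6
  -- The index of the theorem is 3 p^(2α+1) s.
  s = 2 * p * n + 2 * i + p
  M = p ^ (2 * α + 1) * s
  p≡5+6t : p ≡ 5 + t * 6
  p≡5+6t = ≡.trans (DivMod.m≡m%n+[m/n]*n p 6) (cong (_+ t * 6) p%6≡5)
  -- For p = 5 + 6 t, 2 p - 1 = 9 + 12 t = 3 (2 m + 1) with m = 1 + 2 t, and k = p - 1 = 4 + 6 t.
  3[2m+1]≡p+k : 3 * suc (suc (t + t) + suc (t + t)) ≡ p + (4 + t * 6)
  3[2m+1]≡p+k = ≡.trans (double t) (cong (_+ (4 + t * 6)) (≡.sym p≡5+6t))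
    where
    double : ∀ t → 3 * suc (suc (t + t) + suc (t + t)) ≡ (5 + t * 6) + (4 + t * 6)
    double = solve-∀
  5≤p : 5 ≤ p
  5≤p = ≡.subst (5 ≤_) (≡.sym p≡5+6t) (ℕₚ.m≤m+n 5 (t * 6))
  1≤p : 1 ≤ p
  1≤p = ℕₚ.≤-trans (s≤s z≤n) 5≤p
  1≤M : 1 ≤ M
  1≤M = ℕₚ.*-mono-≤ (ℕₚ.m^n>0 p {{ℕ.>-nonZero 1≤p}} (2 * α + 1)) (ℕₚ.≤-trans 1≤p (ℕₚ.m≤n+m p (2 * p * n + 2 * i)))
  index≡3M : 6 * p ^ (2 * α + 2) * n + (6 * i + 3 * p) * p ^ (2 * α + 1) ≡ M * 3
  index≡3M = ≡.trans
    (cong (λ k → 6 * p ^ k * n + (6 * i + 3 * p) * p ^ (2 * α + 1)) (ℕₚ.+-suc (2 * α) 1))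
    (factorise p (p ^ (2 * α + 1)) n i)
    where
    factorise : ∀ p a n i → 6 * (p * a) * n + (6 * i + 3 * p) * a ≡ a * (2 * p * n + 2 * i + p) * 3
    factorise = solve-∀
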